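{- For every fixed $k$, the formulas $\mathrm{Schrijver}_{n,k}$ (which express that the stable Kneser graph $SKn_{n,k}$ is $(n-2k+1)$-colorable, and are unsatisfiable) have Frege proofs (of unsatisfiability) of size polynomial in $|\mathrm{Schrijver}_{n,k}|$.
   Context: A $k$-subset $A$ of $[n]=\{1,\dots,n\}$ is stable if it contains no two consecutive elements, where $n$ and $1$ are also considered consecutive. The stable Kneser graph $SKn_{n,k}$ (with $n\ge 2k$) has the stable $k$-subsets of $[n]$ as vertices, two sets being adjacent iff they are disjoint. $\mathrm{Schrijver}_{n,k}$ is the following CNF formula for $G=SKn_{n,k}$ and $c=n-2k+1$ colors. Variables $X_{v,i}$ for $v\in V(G)$, $1\le i\le c$, and $Y_{v,w}$ for each set $\{v,w\}$ of distinct vertices. Clauses: unit clause $Y_{v,w}$ for each edge, $\overline{Y_{v,w}}$ for each non-edge; $X_{v,1}\vee\cdots\vee X_{v,c}$ for each $v$; $\overline{X_{v,i}}\vee\overline{X_{v,j}}$ for each $v$ and $1\le i<j\le c$; $\overline{Y_{v,w}}\vee\overline{X_{v,i}}\vee\overline{X_{w,i}}$ for all $\{v,w\}$ and $1\le i\le c$. A Frege system is a sound and complete propositional proof system with finitely many axiom schemes and inference rules (all are polynomially equivalent; fix one whose only rule is modus ponens). The length (size) of a proof is measured by the number of clauses in it. A proof for an unsatisfiable formula means a refutation. -}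

module Defs where

open import Data.Bool.Base using (if_then_else_)
open import Data.Fin.Base using (Fin; toℕ)
open import Data.Fin.Properties using (all?)
open import Data.Fin.Subset using (Subset; inside; outside; _∈_; _∩_; ∣_∣; Empty)
open import Data.Fin.Subset.Properties using (_∈?_; nonempty?)
open import Data.List.Base
  using (List; []; _∷_; [_]; _++_; map; concatMap; filter; foldr; length; lookup; allFin)
import Data.List.Membership.Propositional as List
open import Data.Nat.Base using (ℕ; suc; _+_; _*_; _∸_)
open import Data.Nat.ListAction using (sum)
import Data.Nat.Properties as ℕ
open import Data.Product.Base using (Σ; _×_; _,_; proj₁)
open import Data.Sum.Base using (_⊎_)
import Data.Vec.Base as Vec
open import Relation.Binary.Core using (Rel)
open import Relation.Binary.Definitions using (Decidable)
open import Relation.Binary.PropositionalEquality.Core using (_≡_)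
open import Relation.Nullary.Decidable using (Dec; does; ¬?; _×-dec_; _⊎-dec_; _→-dec_)
open import Relation.Nullary.Negation.Core using (¬_)
open import Level using (0ℓ)

------------------------------------------------------------------------
-- Stable Kneser graphs

-- The ground set [n] is Fin n, so its elements are numbered from 0: the
-- second alternative says that i is the last element and j the first.
Consecutive : ∀ {n} → Rel (Fin n) 0ℓ
Consecutive {n} i j = toℕ j ≡ suc (toℕ i) ⊎ (suc (toℕ i) ≡ n × toℕ j ≡ 0)

consecutive? : ∀ {n} → Decidable (Consecutive {n})
consecutive? {n} i j =
  (toℕ j ℕ.≟ suc (toℕ i)) ⊎-dec ((suc (toℕ i) ℕ.≟ n) ×-dec (toℕ j ℕ.≟ 0))

Stable : ∀ {n} → Subset n → Set
Stable A = ∀ i j → i ∈ A → j ∈ A → ¬ Consecutive i j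

stable? : ∀ {n} (A : Subset n) → Dec (Stable A)
stable? A = all? λ i → all? λ j →
  (i ∈? A) →-dec ((j ∈? A) →-dec ¬? (consecutive? i j))

subsets : ∀ n → List (Subset n)
subsets 0       = [ Vec.[] ]
subsets (suc n) = map (inside Vec.∷_) (subsets n) ++ map (outside Vec.∷_) (subsets n)

stableSubsets : ∀ n → ℕ → List (Subset n)
stableSubsets n k = filter (λ A → (∣ A ∣ ℕ.≟ k) ×-dec stable? A) (subsets n)

-- A vertex is a stable k-subset, represented by its position in the
-- duplicate-free list stableSubsets n k.
SKVertex : ℕ → ℕ → Set
SKVertex n k = Fin (length (stableSubsets n k))

⟪_⟫ : ∀ {n k} → SKVertex n k → Subset n
⟪_⟫ {n} {k} v = lookup (stableSubsets n k) v

SKAdjacent : ∀ n k → Rel (SKVertex n k) 0ℓ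
SKAdjacent n k v w = Empty (⟪_⟫ {n} {k} v ∩ ⟪_⟫ {n} {k} w)

skAdjacent? : ∀ n k → Decidable (SKAdjacent n k)
skAdjacent? n k v w = ¬? (nonempty? (⟪_⟫ {n} {k} v ∩ ⟪_⟫ {n} {k} w))

------------------------------------------------------------------------
-- CNF formulas

data Literal (V : Set) : Set where
  pos neg : V → Literal V

Clause : Set → Set
Clause V = List (Literal V)

CNF : Set → Set
CNF V = List (Clause V)

-- The number of occurrences of literals.
∥_∥ : ∀ {V} → CNF V → ℕ
∥ F ∥ = sum (map length F)

------------------------------------------------------------------------
-- Colouring formulas

-- All pairs (x , y) with x strictly before y in the list.
pairs : ∀ {A : Set} → List A → List (A × A)
pairs []       = []
pairs (x ∷ xs) = map (x ,_) xs ++ pairs xs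

-- Y v w, which only ever occurs with v < w, is the variable of the
-- unordered pair {v , w}.
data ColVar (N c : ℕ) : Set where
  X : Fin N → Fin c → ColVar N c
  Y : Fin N → Fin N → ColVar N c

module _ {N : ℕ} {Adj : Rel (Fin N) 0ℓ} (adj? : Decidable Adj) (c : ℕ) where

  graphClauses : CNF (ColVar N c)
  graphClauses =
    map (λ (v , w) → [ (if does (adj? v w) then pos (Y v w) else neg (Y v w)) ])
        (pairs (allFin N))

  someColour : CNF (ColVar N c)
  someColour = map (λ v → map (λ i → pos (X v i)) (allFin c)) (allFin N)

  uniqueColour : CNF (ColVar N c)
  uniqueColour =
    concatMap (λ v → map (λ (i , j) → neg (X v i) ∷ neg (X v j) ∷ [])
                         (pairs (allFin c)))
              (allFin N)

  properColour : CNF (ColVar N c)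
  properColour =
    concatMap (λ (v , w) → map (λ i → neg (Y v w) ∷ neg (X v i) ∷ neg (X w i) ∷ [])
                               (allFin c))
              (pairs (allFin N))

  colouringCNF : CNF (ColVar N c)
  colouringCNF = graphClauses ++ someColour ++ uniqueColour ++ properColour

SchrijverVar : ℕ → ℕ → Set
SchrijverVar n k = ColVar (length (stableSubsets n k)) (n ∸ 2 * k + 1)

Schrijver : ∀ n k → CNF (SchrijverVar n k)
Schrijver n k = colouringCNF (skAdjacent? n k) (n ∸ 2 * k + 1)

------------------------------------------------------------------------
-- A Frege system

infixr 7 _∧_
infixr 6 _∨_
infixr 5 _⇒_

data Formula (V : Set) : Set where
  var         : V → Formula V
  ⊥           : Formula V
  _∧_ _∨_ _⇒_ : Formula V → Formula V → Formula V

∼_ : ∀ {V} → Formula V → Formula V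
∼ A = A ⇒ ⊥

-- The standard axiom schemes of the Hilbert calculus for classical
-- propositional logic; ⊥ ⇒ A is derivable from K, S and dne.
data Axiom {V : Set} : Formula V → Set where
  K    : ∀ A B → Axiom (A ⇒ B ⇒ A)
  S    : ∀ A B C → Axiom ((A ⇒ B ⇒ C) ⇒ (A ⇒ B) ⇒ A ⇒ C)
  ∧-i  : ∀ A B → Axiom (A ⇒ B ⇒ A ∧ B)
  ∧-e₁ : ∀ A B → Axiom (A ∧ B ⇒ A)
  ∧-e₂ : ∀ A B → Axiom (A ∧ B ⇒ B)
  ∨-i₁ : ∀ A B → Axiom (A ⇒ A ∨ B)
  ∨-i₂ : ∀ A B → Axiom (B ⇒ A ∨ B)
  ∨-e  : ∀ A B C → Axiom ((A ⇒ C) ⇒ (B ⇒ C) ⇒ A ∨ B ⇒ C)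
  dne  : ∀ A → Axiom (∼ ∼ A ⇒ A)

-- Proof Γ ls: ls, read from right to left, is a sequence of formulas each
-- of which is a hypothesis from Γ, an axiom, or follows by modus ponens
-- from earlier ones (a line may be used any number of times).
data Proof {V : Set} (Γ : List (Formula V)) : List (Formula V) → Set where
  []    : Proof Γ []
  hyp   : ∀ {A ls} → A List.∈ Γ → Proof Γ ls → Proof Γ (A ∷ ls)
  axiom : ∀ {A ls} → Axiom A → Proof Γ ls → Proof Γ (A ∷ ls)
  mp    : ∀ {A B ls} → (A ⇒ B) List.∈ ls → A List.∈ ls → Proof Γ ls → Proof Γ (B ∷ ls)

literalFormula : ∀ {V} → Literal V → Formula V
literalFormula (pos x) = var x
literalFormula (neg x) = ∼ var x

clauseFormula : ∀ {V} → Clause V → Formula V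
clauseFormula []           = ⊥
clauseFormula (l ∷ [])     = literalFormula l
clauseFormula (l ∷ m ∷ ls) = literalFormula l ∨ clauseFormula (m ∷ ls)

Refutation : ∀ {V} → CNF V → Set
Refutation {V} F = Σ (List (Formula V)) λ ls → Proof (map clauseFormula F) (⊥ ∷ ls)

-- The number of lines, including the final ⊥.
size : ∀ {V} {F : CNF V} → Refutation F → ℕ
size π = suc (length (proj₁ π))

------------------------------------------------------------------------
-- Polynomials with natural-number coefficients, constant term first

Polynomial : Set
Polynomial = List ℕ

eval : Polynomial → ℕ → ℕ
eval p x = foldr (λ a r → a + x * r) 0 p

{-# OPTIONS --safe #-}
module Submission where

-- For large n the colour classes are counted: if none of the c ≤ n classes is
-- a star, then every vertex A of colour i contains one of at most k² pairs
-- {x , y} determined by i, namely x in a fixed set v of colour i and y in a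
-- fixed set of colour i avoiding x.  Among the arithmetic progressions used as
-- vertices below any two share at most one element, so that more than c k² of
-- them contradict the pigeonhole principle.  Hence some class is a star; deleting
-- its centre and its colour leaves a (c - 1)-colouring of the graph for n - 1.
-- Since only lines are counted, the formulas defining the new colouring may be
-- substituted for the variables and the step repeated, each time at polynomial
-- cost, until n is below a constant depending on k only; there brute force is
-- affordable.  What remains is that there is no colouring, i.e. Schrijver's
-- theorem.  It follows from Tucker's lemma for sign vectors: a vector with few
-- sign changes is labelled by their number, any other one by the largest colour
-- of a vertex inside its positive or its negative part.

open import Defs
open import Data.Bool.Base using (Bool; true; false; not; _xor_; if_then_else_) renaming (_∧_ to _&&_)
open import Data.Bool.Properties using (xor-same; xor-assoc; xor-identityʳ; not-involutive; ¬-not)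
  renaming (_≟_ to _≟ᵇ_)
open import Data.Bool.Solver using (module xor-∧-Solver)
open import Data.Empty using () renaming (⊥ to Void; ⊥-elim to void)
open import Data.Fin.Base using (Fin; zero; suc; toℕ; punchIn; punchOut) renaming (_<_ to _<ᶠ_)
open import Data.Fin.Properties using (all?; toℕ-injective; toℕ<n; punchIn-punchOut; punchIn-injective)
  renaming (_≟_ to _≟ᶠ_; <-cmp to <ᶠ-cmp)
open import Data.Fin.Subset using (Subset; inside; outside; Empty; _∩_; ∣_∣)
  renaming (_∈_ to _∈ₛ_; _∉_ to _∉ₛ_; ⊥ to ∅)
open import Data.Fin.Subset.Properties
  using (_∈?_; nonempty?; x∈p∩q⁻; x∈p∩q⁺; ∉⊥; ∣⊥∣≡0; ∩-idem; ∩-comm; Empty-unique)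
open import Data.List.Base as List
  using (List; []; _∷_; [_]; _++_; map; concatMap; filter; length; cartesianProduct; allFin; upTo;
         tabulate)
open import Data.List.Membership.Propositional using (_∈_; find)
open import Data.List.Membership.Propositional.Properties
open import Data.List.Properties
  using (map-∘; map-++; length-map; length-++; length-filter; length-tabulate; length-applyUpTo;
         filter-++)
open import Data.List.Relation.Binary.Subset.Propositional using (_⊆_)
open import Data.List.Relation.Unary.All as All using (All; []; _∷_)
import Data.List.Relation.Unary.All.Properties as All
open import Data.List.Relation.Unary.AllPairs as AllPairs using (AllPairs; []; _∷_)
import Data.List.Relation.Unary.AllPairs.Properties as AllPairs
open import Data.List.Relation.Unary.Any as Any using (here; there)
open import Data.List.Relation.Unary.Any.Properties using (lookup-index)
open import Data.List.Relation.Unary.Unique.Propositional.Properties using (upTo⁺; cartesianProduct⁺)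
open import Data.Maybe.Base as Maybe using (Maybe; just; nothing)
import Data.Maybe.Properties as Maybe
open import Data.Nat.Base
  using (ℕ; zero; suc; _+_; _*_; _∸_; _^_; _/_; _%_; _⊔_; _⊓_; _≤_; _<_; z≤n; s≤s; s≤s⁻¹; NonZero;
    >-nonZero)
open import Data.Nat.DivMod
  using (m≡m%n+[m/n]*n; m%n<n; /-monoˡ-≤; m*n/n≡m; m/n*n≤m; [m+kn]%n≡m%n; m<n⇒m%n≡m)
open import Data.Nat.ListAction using (sum)
open import Data.Nat.ListAction.Properties using (sum-++)
open import Data.Nat.Properties
open import Data.Nat.Solver using (module +-*-Solver)
open import Data.Product.Base using (Σ; ∃; _×_; _,_; proj₁; proj₂)
open import Data.Sum.Base using (_⊎_; inj₁; inj₂)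
open import Data.Vec.Base as Vec using (Vec; lookup; insertAt)
open import Data.Vec.Properties
  using (lookup-map; insertAt-lookup; insertAt-punchIn; []=⇒lookup; lookup⇒[]=)
open import Data.Vec.Relation.Binary.Pointwise.Inductive as Pointwise using (Pointwise; []; _∷_)
open import Function.Base using (_∘_; id)
open import Relation.Binary.Definitions using (Tri; tri<; tri≈; tri>)
open import Relation.Binary.PropositionalEquality
  using (_≡_; _≢_; refl; sym; trans; cong; cong₂; subst; subst₂; module ≡-Reasoning)
open import Relation.Nullary.Decidable using (Dec; does; yes; no; ¬?; _×-dec_; _→-dec_; dec-true)
open import Relation.Nullary.Negation.Core using (¬_; contradiction)

-- Chains modulo 2 and Tucker's lemma

-- Why progressions: if two pigeons share at most one element, each pair lies in at most one of
-- them, so the count becomes a plain injection of pigeons into holes. About (n / `block k`)²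
-- progressions face at most n k² pairs; quadratic beats linear once n exceeds a constant depending
-- on k.
--
-- Fixed sets of a colour, and the star to be deleted, depend on the unknown colouring. They are
-- chosen inside the calculus by `atFirst`, which selects the first list entry satisfying a formula.
-- All facts about concrete sets (membership, disjointness, stability) are decided outside the
-- calculus; only colour statements become formulas.
--
-- Cuts add numbers of lines and do not multiply them. So up to n reductions cost n times one fixed
-- power, however large the substituted formulas become. Schrijver's theorem gets no propositional
-- proof: it is applied outside the calculus, at leaves of a case tree where every colour variable
-- is decided.

⨁ : ∀ {A : Set} → (A → Bool) → List A → Bool
⨁ f []       = false
⨁ f (x ∷ xs) = f x xor ⨁ f xs

module _ {A : Set} where

  ⨁-++ : (f : A → Bool) (xs ys : List A) → ⨁ f (xs ++ ys) ≡ ⨁ f xs xor ⨁ f ys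
  ⨁-++ f []       ys = refl
  ⨁-++ f (x ∷ xs) ys = trans (cong (f x xor_) (⨁-++ f xs ys)) (sym (xor-assoc (f x) _ _))

  ⨁-map : ∀ {B : Set} (f : A → Bool) (g : B → A) xs → ⨁ f (map g xs) ≡ ⨁ (f ∘ g) xs
  ⨁-map f g []       = refl
  ⨁-map f g (x ∷ xs) = cong (f (g x) xor_) (⨁-map f g xs)

  ⨁-concatMap : ∀ {B : Set} (f : A → Bool) (g : B → List A) xs →
                ⨁ f (concatMap g xs) ≡ ⨁ (⨁ f ∘ g) xs
  ⨁-concatMap f g []       = refl
  ⨁-concatMap f g (x ∷ xs) =
    trans (⨁-++ f (g x) (concatMap g xs)) (cong (⨁ f (g x) xor_) (⨁-concatMap f g xs))

  ⨁-cong-∈ : {f g : A → Bool} (xs : List A) → (∀ {x} → x ∈ xs → f x ≡ g x) → ⨁ f xs ≡ ⨁ g xs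
  ⨁-cong-∈ []       f≡g = refl
  ⨁-cong-∈ (x ∷ xs) f≡g = cong₂ _xor_ (f≡g (here refl)) (⨁-cong-∈ xs (f≡g ∘ there))

  ⨁-cong : {f g : A → Bool} → (∀ x → f x ≡ g x) → ∀ xs → ⨁ f xs ≡ ⨁ g xs
  ⨁-cong f≡g xs = ⨁-cong-∈ xs λ {x} _ → f≡g x

  ⨁-xor : (f g : A → Bool) (xs : List A) → ⨁ (λ x → f x xor g x) xs ≡ ⨁ f xs xor ⨁ g xs
  ⨁-xor f g []       = refl
  ⨁-xor f g (x ∷ xs) = trans (cong ((f x xor g x) xor_) (⨁-xor f g xs))
    (solve 4 (λ a b c d → (a :+ b) :+ (c :+ d) := (a :+ c) :+ (b :+ d)) refl
       (f x) (g x) (⨁ f xs) (⨁ g xs))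
    where open xor-∧-Solver

  ⨁-&& : ∀ b (f : A → Bool) (xs : List A) → ⨁ (λ x → b && f x) xs ≡ b && ⨁ f xs
  ⨁-&& true  f xs       = ⨁-cong (λ _ → refl) xs
  ⨁-&& false f []       = refl
  ⨁-&& false f (x ∷ xs) = ⨁-&& false f xs

faces : ∀ {A : Set} → List A → List (List A)
faces []       = []
faces (x ∷ xs) = xs ∷ map (x ∷_) (faces xs)

-- Functions on ordered simplices are cochains modulo 2, and this is the coboundary. A chain is a
-- list of simplices whose repetitions cancel in `⨁`; instead of forming its boundary, one sums
-- `∂ f` over it for arbitrary `f`.
∂ : ∀ {A : Set} → (List A → Bool) → List A → Bool
∂ f τ = ⨁ f (faces τ)

∂-∷ : ∀ {A : Set} (f : List A → Bool) x xs → ∂ f (x ∷ xs) ≡ f xs xor ∂ (f ∘ (x ∷_)) xs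
∂-∷ f x xs = cong (f xs xor_) (⨁-map f (x ∷_) (faces xs))

faces-map : ∀ {A B : Set} (g : A → B) xs → faces (map g xs) ≡ map (map g) (faces xs)
faces-map g []       = refl
faces-map g (x ∷ xs) = cong (map g xs ∷_) (begin
  map (g x ∷_) (faces (map g xs))        ≡⟨ cong (map (g x ∷_)) (faces-map g xs) ⟩
  map (g x ∷_) (map (map g) (faces xs))  ≡⟨ map-∘ (faces xs) ⟨
  map (map g ∘ (x ∷_)) (faces xs)        ≡⟨ map-∘ (faces xs) ⟩
  map (map g) (map (x ∷_) (faces xs))    ∎)
  where open ≡-Reasoning

∂-map : ∀ {A B : Set} (f : List B → Bool) (g : A → B) xs → ∂ f (map g xs) ≡ ∂ (f ∘ map g) xs
∂-map f g xs = trans (cong (⨁ f) (faces-map g xs)) (⨁-map f (map g) (faces xs))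

-- Triangulated spheres of sign vectors

SignVec : ℕ → Set
SignVec = Vec (Maybe Bool)

infixr 5 0∷_ +∷_
0∷_ +∷_ : ∀ {d} → SignVec d → SignVec (suc d)
0∷ x = nothing Vec.∷ x
+∷ x = just true Vec.∷ x

-- For σ = x₁, ..., xₘ the pieces are the cone +p, +x₁, ..., +xₘ and the simplices 0x₁, ..., 0xᵢ,
-- +xᵢ, ..., +xₘ. With p zero these are the flags over σ in which the first coordinate turns from 0
-- to + at some point. In the recursion the preceding vertex takes over the role of p.
prism : ∀ {d} → SignVec d → List (SignVec d) → List (List (SignVec (suc d)))
prism p []      = [ [ +∷ p ] ]
prism p (x ∷ σ) = map +∷_ (p ∷ x ∷ σ) ∷ map ((0∷ x) ∷_) (prism x σ)

-- The base occurs only in the first simplex of the prism, which cancels modulo 2 against the added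
-- term. This compares the prisms over different bases that meet in `∂-prism`.
prism-base : ∀ {d} (f : List (SignVec (suc d)) → Bool) p q σ →
  f (map +∷_ (p ∷ σ)) xor ⨁ f (prism p σ) ≡ f (map +∷_ (q ∷ σ)) xor ⨁ f (prism q σ)
prism-base f p q [] = trans (lemma (f ([ +∷ p ]))) (sym (lemma (f ([ +∷ q ]))))
  where
  lemma : ∀ b → b xor (b xor false) ≡ false
  lemma b = trans (cong (b xor_) (xor-identityʳ b)) (xor-same b)
prism-base f p q (x ∷ σ) =
  trans (lemma (f (map +∷_ (p ∷ x ∷ σ))) rest) (sym (lemma (f (map +∷_ (q ∷ x ∷ σ))) rest))
  where
  rest = ⨁ f (map ((0∷ x) ∷_) (prism x σ))
  lemma : ∀ b c → b xor (b xor c) ≡ c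
  lemma b c = trans (sym (xor-assoc b b c)) (cong (_xor c) (xor-same b))

-- The interior walls cancel in pairs and the cone from `+∷ p` closes the top, so that only the
-- bottom and the prism over the boundary of σ remain.
∂-prism : ∀ {d} (f : List (SignVec (suc d)) → Bool) p σ →
  ⨁ (∂ f) (prism p σ) ≡ f (map 0∷_ σ) xor ∂ (λ ρ → ⨁ f (prism p ρ)) σ
∂-prism f p []      = cong (_xor false) (xor-identityʳ (f []))
∂-prism f p (x ∷ σ) = begin
  ∂ f (map +∷_ (p ∷ x ∷ σ)) xor ⨁ (∂ f) (map ((0∷ x) ∷_) (prism x σ))
    ≡⟨ cong₂ _xor_ top rest ⟩
  (A xor (B xor D)) xor (E xor (G xor H))
    ≡⟨ cong (λ e → (A xor (B xor D)) xor (e xor (G xor H))) swap ⟩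
  (A xor (B xor D)) xor ((A xor (B xor P)) xor (G xor H))
    ≡⟨ solve 6 (λ a b d g h p → (a :+ (b :+ d)) :+ ((a :+ (b :+ p)) :+ (g :+ h))
                              := g :+ (p :+ (d :+ h))) refl A B D G H P ⟩
  G xor (P xor (D xor H))
    ≡⟨ cong (λ e → G xor (P xor e)) side ⟨
  G xor (P xor ∂ ((λ ρ → ⨁ f (prism p ρ)) ∘ (x ∷_)) σ)
    ≡⟨ cong (G xor_) (∂-∷ (λ ρ → ⨁ f (prism p ρ)) x σ) ⟨
  G xor ∂ (λ ρ → ⨁ f (prism p ρ)) (x ∷ σ) ∎
  where
  open ≡-Reasoning
  open xor-∧-Solver
  f′ = f ∘ ((0∷ x) ∷_)
  A = f (map +∷_ (x ∷ σ))
  B = f (map +∷_ (p ∷ σ))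
  D = ∂ (λ ρ → f (map +∷_ (p ∷ x ∷ ρ))) σ
  E = ⨁ f (prism x σ)
  G = f (map 0∷_ (x ∷ σ))
  H = ∂ (λ ρ → ⨁ f′ (prism x ρ)) σ
  P = ⨁ f (prism p σ)
  top : ∂ f (map +∷_ (p ∷ x ∷ σ)) ≡ A xor (B xor D)
  top = trans (∂-map f +∷_ (p ∷ x ∷ σ)) (trans (∂-∷ (f ∘ map +∷_) p (x ∷ σ))
          (cong (A xor_) (∂-∷ (λ τ → f (map +∷_ (p ∷ τ))) x σ)))
  rest : ⨁ (∂ f) (map ((0∷ x) ∷_) (prism x σ)) ≡ E xor (G xor H)
  rest = begin
    ⨁ (∂ f) (map ((0∷ x) ∷_) (prism x σ))   ≡⟨ ⨁-map (∂ f) _ (prism x σ) ⟩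
    ⨁ (∂ f ∘ ((0∷ x) ∷_)) (prism x σ)       ≡⟨ ⨁-cong (∂-∷ f (0∷ x)) (prism x σ) ⟩
    ⨁ (λ τ → f τ xor ∂ f′ τ) (prism x σ)    ≡⟨ ⨁-xor f (∂ f′) (prism x σ) ⟩
    E xor ⨁ (∂ f′) (prism x σ)              ≡⟨ cong (E xor_) (∂-prism f′ x σ) ⟩
    E xor (G xor H)                         ∎
  side : ∂ (λ ρ → ⨁ f (prism p (x ∷ ρ))) σ ≡ D xor H
  side = trans (⨁-cong (λ ρ → cong (f (map +∷_ (p ∷ x ∷ ρ)) xor_) (⨁-map f _ (prism x ρ))) (faces σ))
               (⨁-xor _ _ (faces σ))
  swap : E ≡ A xor (B xor P)
  swap = begin
    E                  ≡⟨ solve 2 (λ a e → e := a :+ (a :+ e)) refl A E ⟩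
    A xor (A xor E)    ≡⟨ cong (A xor_) (prism-base f x p σ) ⟩
    A xor (B xor P)    ∎

neg-vec : ∀ {d} → SignVec d → SignVec d
neg-vec = Vec.map (Maybe.map not)

zero-vec : ∀ {d} → SignVec d
zero-vec = Vec.replicate _ nothing

-- The barycentric subdivision of the boundary of the cross-polytope, given by its maximal flags.
-- `sphere 0` contains the empty simplex, as in augmented chain complexes; it starts the parity
-- induction of `fan` at one.
hemisphere sphere : ∀ d → List (List (SignVec d))
hemisphere zero    = []
hemisphere (suc d) = concatMap (prism zero-vec) (sphere d)
sphere zero        = [ [] ]
sphere (suc d)     = hemisphere (suc d) ++ map (map neg-vec) (hemisphere (suc d))

neg-vec-involutive : ∀ {d} (x : SignVec d) → neg-vec (neg-vec x) ≡ x
neg-vec-involutive Vec.[]                = refl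
neg-vec-involutive (nothing Vec.∷ x) = cong (nothing Vec.∷_) (neg-vec-involutive x)
neg-vec-involutive (just b Vec.∷ x)  =
  cong₂ (λ c → just c Vec.∷_) (not-involutive b) (neg-vec-involutive x)

map-neg-involutive : ∀ {d} (σ : List (SignVec d)) → map neg-vec (map neg-vec σ) ≡ σ
map-neg-involutive []      = refl
map-neg-involutive (x ∷ σ) = cong₂ _∷_ (neg-vec-involutive x) (map-neg-involutive σ)

⨁-sphere : ∀ {d} (f : List (SignVec (suc d)) → Bool) →
  ⨁ f (sphere (suc d)) ≡ ⨁ f (hemisphere (suc d)) xor ⨁ (f ∘ map neg-vec) (hemisphere (suc d))
⨁-sphere {d} f = trans (⨁-++ f (hemisphere (suc d)) _)
  (cong (⨁ f (hemisphere (suc d)) xor_) (⨁-map f (map neg-vec) (hemisphere (suc d))))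

sphere-symmetric : ∀ d (f : List (SignVec d) → Bool) → ⨁ (f ∘ map neg-vec) (sphere d) ≡ ⨁ f (sphere d)
sphere-symmetric zero    f = refl
sphere-symmetric (suc d) f = begin
  ⨁ (f ∘ ν) (sphere (suc d))     ≡⟨ ⨁-sphere (f ∘ ν) ⟩
  ⨁ (f ∘ ν) H xor ⨁ (f ∘ ν ∘ ν) H
    ≡⟨ cong (⨁ (f ∘ ν) H xor_) (⨁-cong (λ σ → cong f (map-neg-involutive σ)) H) ⟩
  ⨁ (f ∘ ν) H xor ⨁ f H          ≡⟨ solve 2 (λ a b → a :+ b := b :+ a) refl (⨁ (f ∘ ν) H) (⨁ f H) ⟩
  ⨁ f H xor ⨁ (f ∘ ν) H          ≡⟨ ⨁-sphere f ⟨
  ⨁ f (sphere (suc d))           ∎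
  where
  open ≡-Reasoning
  open xor-∧-Solver
  ν = map neg-vec
  H = hemisphere (suc d)

-- Mutual induction: a sphere is closed because its two hemispheres share the equator as boundary,
-- and a hemisphere has no further boundary because the smaller sphere is closed.
∂-sphere     : ∀ d (f : List (SignVec d) → Bool) → ⨁ (∂ f) (sphere d) ≡ false
∂-hemisphere : ∀ d (f : List (SignVec (suc d)) → Bool) →
               ⨁ (∂ f) (hemisphere (suc d)) ≡ ⨁ (f ∘ map 0∷_) (sphere d)

∂-hemisphere d f = begin
  ⨁ (∂ f) (hemisphere (suc d))               ≡⟨ ⨁-concatMap (∂ f) _ (sphere d) ⟩
  ⨁ (⨁ (∂ f) ∘ prism zero-vec) (sphere d)    ≡⟨ ⨁-cong (∂-prism f zero-vec) (sphere d) ⟩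
  ⨁ (λ σ → f (map 0∷_ σ) xor ∂ g σ) (sphere d) ≡⟨ ⨁-xor (f ∘ map 0∷_) (∂ g) (sphere d) ⟩
  ⨁ (f ∘ map 0∷_) (sphere d) xor ⨁ (∂ g) (sphere d)
                                             ≡⟨ cong (⨁ (f ∘ map 0∷_) (sphere d) xor_) (∂-sphere d g) ⟩
  ⨁ (f ∘ map 0∷_) (sphere d) xor false       ≡⟨ xor-identityʳ _ ⟩
  ⨁ (f ∘ map 0∷_) (sphere d)                 ∎
  where
  open ≡-Reasoning
  g = λ ρ → ⨁ f (prism zero-vec ρ)

∂-sphere zero    f = refl
∂-sphere (suc d) f = begin
  ⨁ (∂ f) (sphere (suc d))                                  ≡⟨ ⨁-sphere (∂ f) ⟩
  ⨁ (∂ f) H xor ⨁ (∂ f ∘ ν) H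
    ≡⟨ cong (⨁ (∂ f) H xor_) (⨁-cong (∂-map f neg-vec) H) ⟩
  ⨁ (∂ f) H xor ⨁ (∂ (f ∘ ν)) H
    ≡⟨ cong₂ _xor_ (∂-hemisphere d f) (∂-hemisphere d (f ∘ ν)) ⟩
  ⨁ (f ∘ map 0∷_) Sᵈ xor ⨁ (f ∘ ν ∘ map 0∷_) Sᵈ
    ≡⟨ cong (⨁ (f ∘ map 0∷_) Sᵈ xor_) (⨁-cong (λ σ → cong f (commute σ)) Sᵈ) ⟩
  ⨁ (f ∘ map 0∷_) Sᵈ xor ⨁ (f ∘ map 0∷_ ∘ map neg-vec) Sᵈ
    ≡⟨ cong (⨁ (f ∘ map 0∷_) Sᵈ xor_) (sphere-symmetric d (f ∘ map 0∷_)) ⟩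
  ⨁ (f ∘ map 0∷_) Sᵈ xor ⨁ (f ∘ map 0∷_) Sᵈ                   ≡⟨ xor-same (⨁ (f ∘ map 0∷_) Sᵈ) ⟩
  false                                                     ∎
  where
  open ≡-Reasoning
  ν = map neg-vec
  H = hemisphere (suc d)
  Sᵈ = sphere d
  commute : ∀ σ → ν (map 0∷_ σ) ≡ map 0∷_ (map neg-vec σ)
  commute []      = refl
  commute (x ∷ σ) = cong (_ ∷_) (commute σ)

⨁-witness : ∀ {A : Set} (f : A → Bool) xs → ⨁ f xs ≡ true → ∃ λ x → x ∈ xs × f x ≡ true
⨁-witness f (x ∷ xs) eq with f x in fx
... | true  = x , here refl , fx
... | false with ⨁-witness f xs eq
...   | y , y∈xs , fy = y , there y∈xs , fy

-- Alternating sequences of labels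

Label : Set
Label = Bool × ℕ

sign : Label → Bool
sign = proj₁

mag : Label → ℕ
mag = proj₂

opposite : Label → Label
opposite (s , m) = not s , m

_==_ : Bool → Bool → Bool
true  == b = b
false == b = not b

alternates : Bool → List Label → Bool
alternates s []      = true
alternates s (x ∷ l) = (sign x == s) && alternates (not s) l

alternates-neg : ∀ s l → alternates (not s) l ≡ alternates s (map opposite l)
alternates-neg s []            = refl
alternates-neg s ((b , m) ∷ l) = cong₂ _&&_ (lemma b s) (alternates-neg (not s) l)
  where
  lemma : ∀ b s → (b == not s) ≡ (not b == s)
  lemma true  s = refl
  lemma false s = not-involutive s

-- A sequence alternating from `s` has one face alternating from `s`, without the last entry; one
-- alternating from `not s` also has one, without the first entry. Any other sequence has none or
-- two such faces, the two arising from two equal neighbouring signs.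
∂-alternates : ∀ s x l → ∂ (alternates s) (x ∷ l) ≡ alternates s (x ∷ l) xor alternates (not s) (x ∷ l)
∂-alternates s (b , m) [] = lemma b s
  where
  lemma : ∀ b s → true ≡ ((b == s) && true) xor ((b == not s) && true)
  lemma true  true  = refl
  lemma true  false = refl
  lemma false true  = refl
  lemma false false = refl
∂-alternates s x@(b , m) l@(y ∷ l′) = begin
  ∂ (alternates s) (x ∷ l)
    ≡⟨ ∂-∷ (alternates s) x l ⟩
  alternates s l xor ∂ (λ τ → (b == s) && alternates (not s) τ) l
    ≡⟨ cong (alternates s l xor_) (⨁-&& (b == s) (alternates (not s)) (faces l)) ⟩
  alternates s l xor ((b == s) && ∂ (alternates (not s)) l)
    ≡⟨ cong (λ e → alternates s l xor ((b == s) && e)) (∂-alternates (not s) y l′) ⟩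
  alternates s l xor ((b == s) && (alternates (not s) l xor alternates (not (not s)) l))
    ≡⟨ cong (λ t → alternates s l xor ((b == s) && (alternates (not s) l xor alternates t l)))
            (not-involutive s) ⟩
  alternates s l xor ((b == s) && (alternates (not s) l xor alternates s l))
    ≡⟨ lemma b s (alternates s l) (alternates (not s) l) ⟩
  ((b == s) && alternates (not s) l) xor ((b == not s) && alternates s l)
    ≡⟨ cong (λ t → ((b == s) && alternates (not s) l) xor ((b == not s) && alternates t l))
            (not-involutive s) ⟨
  alternates s (x ∷ l) xor alternates (not s) (x ∷ l) ∎
  where
  open ≡-Reasoning
  lemma : ∀ b s u v → u xor ((b == s) && (v xor u)) ≡ ((b == s) && v) xor ((b == not s) && u)
  lemma b s u v = trans (solve 3 (λ u v q → u :+ q :* (v :+ u) := q :* v :+ (con true :+ q) :* u)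
                               refl u v (b == s))
                        (cong (λ q → ((b == s) && v) xor (q && u)) (flip b s))
    where
    open xor-∧-Solver
    flip : ∀ b s → true xor (b == s) ≡ (b == not s)
    flip true  s = refl
    flip false s = refl

insert : Label → List Label → List Label
insert x []      = [ x ]
insert x (y ∷ l) with mag x ≤? mag y
... | yes _ = x ∷ y ∷ l
... | no  _ = y ∷ insert x l

sort : List Label → List Label
sort []      = []
sort (x ∷ l) = insert x (sort l)

insert-neg : ∀ x l → insert (opposite x) (map opposite l) ≡ map opposite (insert x l)
insert-neg x []      = refl
insert-neg x (y ∷ l) with mag x ≤? mag y
... | yes _ = refl
... | no  _ = cong (opposite y ∷_) (insert-neg x l)

sort-neg : ∀ l → sort (map opposite l) ≡ map opposite (sort l)
sort-neg []      = refl
sort-neg (x ∷ l) = trans (cong (insert (opposite x)) (sort-neg l)) (insert-neg x (sort l))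

length-insert : ∀ x l → length (insert x l) ≡ suc (length l)
length-insert x []      = refl
length-insert x (y ∷ l) with mag x ≤? mag y
... | yes _ = refl
... | no  _ = cong suc (length-insert x l)

length-sort : ∀ l → length (sort l) ≡ length l
length-sort []      = refl
length-sort (x ∷ l) = trans (length-insert x (sort l)) (cong suc (length-sort l))

insert-All : ∀ {P : Label → Set} {x l} → P x → All P l → All P (insert x l)
insert-All {l = []}    px []         = px ∷ []
insert-All {x = x} {l = y ∷ l} px (py ∷ pl) with mag x ≤? mag y
... | yes _ = px ∷ py ∷ pl
... | no  _ = py ∷ insert-All px pl

sort-All : ∀ {P : Label → Set} {l} → All P l → All P (sort l)
sort-All []        = []
sort-All (px ∷ pl) = insert-All px (sort-All pl)

insert-AllPairs : ∀ {R : Label → Label → Set} → (∀ {x y} → R x y → R y x) →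
                  ∀ {x l} → All (R x) l → AllPairs R l → AllPairs R (insert x l)
insert-AllPairs sym-R {l = []}            []         []         = [] ∷ []
insert-AllPairs sym-R {x} {y ∷ l} (rxy ∷ rx) (ry ∷ rl) with mag x ≤? mag y
... | yes _ = (rxy ∷ rx) ∷ ry ∷ rl
... | no  _ = insert-All (sym-R rxy) ry ∷ insert-AllPairs sym-R rx rl

sort-AllPairs : ∀ {R : Label → Label → Set} → (∀ {x y} → R x y → R y x) →
                ∀ {l} → AllPairs R l → AllPairs R (sort l)
sort-AllPairs sym-R []        = []
sort-AllPairs sym-R (rx ∷ rl) = insert-AllPairs sym-R (sort-All rx) (sort-AllPairs sym-R rl)

Sorted : List Label → Set
Sorted = AllPairs λ x y → mag x ≤ mag y

insert-sorted : ∀ x {l} → Sorted l → Sorted (insert x l)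
insert-sorted x []        = [] ∷ []
insert-sorted x {y ∷ l} (y≤ ∷ ↗l) with mag x ≤? mag y
... | yes x≤y = (x≤y ∷ All.map (≤-trans x≤y) y≤) ∷ y≤ ∷ ↗l
... | no  x≰y = insert-All (≰⇒≥ x≰y) y≤ ∷ insert-sorted x ↗l

sort-sorted : ∀ l → Sorted (sort l)
sort-sorted []      = []
sort-sorted (x ∷ l) = insert-sorted x (sort-sorted l)

insert-least : ∀ x {l} → All (λ y → mag x ≤ mag y) l → insert x l ≡ x ∷ l
insert-least x []        = refl
insert-least x {y ∷ l} (x≤y ∷ _) with mag x ≤? mag y
... | yes _   = refl
... | no  x≰y = contradiction x≤y x≰y

faces-All : ∀ {A : Set} {P : A → Set} {l ρ} → All P l → ρ ∈ faces l → All P ρ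
faces-All (px ∷ pl) (here refl) = pl
faces-All {l = x ∷ l} (px ∷ pl) (there ρ∈) with ∈-map⁻ (x ∷_) ρ∈
... | ρ′ , ρ′∈ , refl = px ∷ faces-All pl ρ′∈

∂-insert : ∀ (f : List Label → Bool) x {l} → Sorted l →
           ∂ f (insert x l) ≡ f l xor ∂ (f ∘ insert x) l
∂-insert f x {[]}    []        = refl
∂-insert f x {y ∷ l} (y≤ ∷ ↗l) with mag x ≤? mag y
... | yes x≤y = trans (∂-∷ f x (y ∷ l)) (cong (f (y ∷ l) xor_) (⨁-cong-∈ (faces (y ∷ l)) λ ρ∈ →
        cong f (sym (insert-least x (faces-All (x≤y ∷ All.map (≤-trans x≤y) y≤) ρ∈)))))
... | no  x≰y = begin
  ∂ f (y ∷ insert x l)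
    ≡⟨ ∂-∷ f y (insert x l) ⟩
  f (insert x l) xor ∂ (f ∘ (y ∷_)) (insert x l)
    ≡⟨ cong (f (insert x l) xor_) (∂-insert (f ∘ (y ∷_)) x ↗l) ⟩
  f (insert x l) xor (f (y ∷ l) xor ∂ (f ∘ (y ∷_) ∘ insert x) l)
    ≡⟨ solve 3 (λ a b c → a :+ (b :+ c) := b :+ (a :+ c)) refl (f (insert x l)) (f (y ∷ l)) _ ⟩
  f (y ∷ l) xor (f (insert x l) xor ∂ (f ∘ (y ∷_) ∘ insert x) l)
    ≡⟨ cong (λ e → f (y ∷ l) xor (f (insert x l) xor e)) (⨁-cong (cong f ∘ skip) (faces l)) ⟨
  f (y ∷ l) xor (f (insert x l) xor ∂ (f ∘ insert x ∘ (y ∷_)) l)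
    ≡⟨ cong (f (y ∷ l) xor_) (∂-∷ (f ∘ insert x) y l) ⟨
  f (y ∷ l) xor ∂ (f ∘ insert x) (y ∷ l) ∎
  where
  open ≡-Reasoning
  open xor-∧-Solver
  skip : ∀ ρ → insert x (y ∷ ρ) ≡ y ∷ insert x ρ
  skip ρ with mag x ≤? mag y
  ... | yes x≤y = contradiction x≤y x≰y
  ... | no  _   = refl

-- Insertion compares magnitudes only and keeps ties in order, so the faces of the sorted list are
-- the sorted faces. This carries `∂-alternates` over to simplices whose labels come in any order.
∂-sort : ∀ (f : List Label → Bool) l → ∂ (f ∘ sort) l ≡ ∂ f (sort l)
∂-sort f []      = refl
∂-sort f (x ∷ l) = begin
  ∂ (f ∘ sort) (x ∷ l)                         ≡⟨ ∂-∷ (f ∘ sort) x l ⟩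
  f (sort l) xor ∂ (f ∘ insert x ∘ sort) l     ≡⟨ cong (f (sort l) xor_) (∂-sort (f ∘ insert x) l) ⟩
  f (sort l) xor ∂ (f ∘ insert x) (sort l)     ≡⟨ ∂-insert f x (sort-sorted l) ⟨
  ∂ f (sort (x ∷ l))                           ∎
  where open ≡-Reasoning

positive : List Label → Bool
positive l = alternates true (sort l)

∂-positive : ∀ x l → ∂ positive (x ∷ l) ≡ positive (x ∷ l) xor positive (map opposite (x ∷ l))
∂-positive x l = begin
  ∂ positive (x ∷ l)                   ≡⟨ ∂-sort (alternates true) (x ∷ l) ⟩
  ∂ (alternates true) (sort (x ∷ l))   ≡⟨ nonempty (sort (x ∷ l)) (length-sort (x ∷ l)) ⟩
  positive (x ∷ l) xor alternates false (sort (x ∷ l))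
    ≡⟨ cong (positive (x ∷ l) xor_) (alternates-neg true (sort (x ∷ l))) ⟩
  positive (x ∷ l) xor alternates true (map opposite (sort (x ∷ l)))
    ≡⟨ cong (λ τ → positive (x ∷ l) xor alternates true τ) (sort-neg (x ∷ l)) ⟨
  positive (x ∷ l) xor positive (map opposite (x ∷ l)) ∎
  where
  open ≡-Reasoning
  nonempty : ∀ {m} τ → length τ ≡ suc m →
             ∂ (alternates true) τ ≡ alternates true τ xor alternates false τ
  nonempty (y ∷ τ) _ = ∂-alternates true y τ

Compatible : Label → Label → Set
Compatible x y = mag x ≡ mag y → sign x ≡ sign y

-- Neighbours of equal magnitude would have equal signs by compatibility, against alternation. So
-- the magnitudes increase strictly, from that of `x` to below `M`.
alternating-bound : ∀ M s x l → Sorted (x ∷ l) → AllPairs Compatible (x ∷ l) →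
  All (λ y → mag y < M) (x ∷ l) →
                    alternates s (x ∷ l) ≡ true → length (x ∷ l) + mag x ≤ M
alternating-bound M s x [] _ _ (x<M ∷ []) _ = x<M
alternating-bound M s x@(a , p) (y@(b , q) ∷ l) ((p≤q ∷ _) ∷ ↗l) ((x~y ∷ _) ∷ ~l) (_ ∷ <M) alt = begin
  suc (suc (length l)) + p    ≡⟨ +-suc (suc (length l)) p ⟨
  suc (length l) + suc p
    ≤⟨ +-monoʳ-≤ (suc (length l)) (≤∧≢⇒< p≤q (λ p≡q → step a b s (x~y p≡q) alt)) ⟩
  suc (length l) + q          ≤⟨ alternating-bound M (not s) y l ↗l ~l <M (tail (a == s) alt) ⟩
  M                           ∎
  where
  open ≤-Reasoning
  tail : ∀ c {d} → (c && d) ≡ true → d ≡ true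
  tail true eq = eq
  step : ∀ a b s {d} → a ≡ b → ¬ ((a == s) && ((b == not s) && d) ≡ true)
  step true  true  true  _ ()
  step true  true  false _ ()
  step false false true  _ ()
  step false false false _ ()

-- Order, sign changes and flags of sign vectors

infix 4 _⊑_

_⊑_ : ∀ {d} → SignVec d → SignVec d → Set
_⊑_ = Pointwise λ a b → a ≡ nothing ⊎ a ≡ b

⊑-refl : ∀ {d} {x : SignVec d} → x ⊑ x
⊑-refl = Pointwise.refl (inj₂ refl)

zero-⊑ : ∀ {d} (x : SignVec d) → zero-vec ⊑ x
zero-⊑ Vec.[]      = []
zero-⊑ (_ Vec.∷ x) = inj₁ refl ∷ zero-⊑ x

-- The number of sign changes in b ∷ x, where zeros are skipped.
changes : ∀ {d} → Bool → SignVec d → ℕ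
changes b     Vec.[]                = 0
changes b     (nothing    Vec.∷ x)  = changes b x
changes true  (just true  Vec.∷ x)  = changes true x
changes true  (just false Vec.∷ x)  = suc (changes false x)
changes false (just true  Vec.∷ x)  = suc (changes true x)
changes false (just false Vec.∷ x)  = changes false x

-- Both counts are 0 for the zero vector. Otherwise the first nonzero entry makes them differ by
-- exactly one. This form is what the comparison of the two counts in the label requires.
Nonzero : ∀ {d} → SignVec d → Set
Nonzero x = changes true x ≢ changes false x

changes-neg : ∀ {d} b (x : SignVec d) → changes (not b) (neg-vec x) ≡ changes b x
changes-neg b     Vec.[]               = refl
changes-neg b     (nothing    Vec.∷ x) = changes-neg b x
changes-neg true  (just true  Vec.∷ x) = changes-neg true x
changes-neg true  (just false Vec.∷ x) = cong suc (changes-neg false x)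
changes-neg false (just true  Vec.∷ x) = cong suc (changes-neg true x)
changes-neg false (just false Vec.∷ x) = changes-neg false x

Nonzero-+∷ : ∀ {d} (x : SignVec d) → Nonzero (+∷ x)
Nonzero-+∷ x eq = 1+n≢n (sym eq)

Nonzero-neg : ∀ {d} {x : SignVec d} → Nonzero x → Nonzero (neg-vec x)
Nonzero-neg {x = x} x≢0 eq = x≢0 (begin
  changes true x             ≡⟨ changes-neg true x ⟨
  changes false (neg-vec x)  ≡⟨ eq ⟨
  changes true (neg-vec x)   ≡⟨ changes-neg false x ⟩
  changes false x            ∎)
  where open ≡-Reasoning

neg-mono : ∀ {d} {x y : SignVec d} → x ⊑ y → neg-vec x ⊑ neg-vec y
neg-mono []               = []
neg-mono (inj₁ refl ∷ xy) = inj₁ refl ∷ neg-mono xy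
neg-mono (inj₂ refl ∷ xy) = inj₂ refl ∷ neg-mono xy

Flag : ∀ {d} → List (SignVec d) → Set
Flag σ = AllPairs _⊑_ σ × All Nonzero σ

prism-above : ∀ {d} {x p : SignVec d} σ {τ} → x ⊑ p → All (x ⊑_) σ → τ ∈ prism p σ → All ((0∷ x) ⊑_) τ
prism-above []      x⊑p _ (here refl) = (inj₁ refl ∷ x⊑p) ∷ []
prism-above (y ∷ σ) x⊑p (x⊑y ∷ x⊑) (here refl) =
  (inj₁ refl ∷ x⊑p) ∷ (inj₁ refl ∷ x⊑y) ∷ All.map⁺ (All.map (inj₁ refl ∷_) x⊑)
prism-above (y ∷ σ) x⊑p (x⊑y ∷ x⊑) (there τ∈) with ∈-map⁻ _ τ∈
... | τ′ , τ′∈ , refl = (inj₁ refl ∷ x⊑y) ∷ prism-above σ x⊑y x⊑ τ′∈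

prism-Flag : ∀ {d} {p : SignVec d} σ {τ} → All (p ⊑_) σ → Flag σ → τ ∈ prism p σ → Flag τ
prism-Flag {p = p} [] _ _ (here refl) = ([] ∷ []) , Nonzero-+∷ p ∷ []
prism-Flag {p = p} (x ∷ σ) p⊑ (⊑σ , _) (here refl) =
  AllPairs.map⁺ (AllPairs.map (inj₂ refl ∷_) (p⊑ ∷ ⊑σ)) ,
  All.map⁺ (All.universal Nonzero-+∷ (p ∷ x ∷ σ))
prism-Flag (x ∷ σ) _ (x⊑ ∷ ⊑σ , x≢0 ∷ σ≢0) (there τ∈) with ∈-map⁻ _ τ∈
... | τ′ , τ′∈ , refl with prism-Flag σ x⊑ (⊑σ , σ≢0) τ′∈
...   | ⊑τ′ , τ′≢0 = prism-above σ ⊑-refl x⊑ τ′∈ ∷ ⊑τ′ , x≢0 ∷ τ′≢0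

prism-length : ∀ {d} (p : SignVec d) σ {τ} → τ ∈ prism p σ → length τ ≡ suc (length σ)
prism-length p []      (here refl) = refl
prism-length p (x ∷ σ) (here refl) = cong (2 +_) (length-map +∷_ σ)
prism-length p (x ∷ σ) (there τ∈) with ∈-map⁻ _ τ∈
... | τ′ , τ′∈ , refl = cong suc (prism-length x σ τ′∈)

hemisphere-Flag : ∀ d {τ} → τ ∈ hemisphere (suc d) → Flag τ × length τ ≡ suc d
sphere-Flag     : ∀ d {σ} → σ ∈ sphere d → Flag σ × length σ ≡ d

hemisphere-Flag d τ∈ with find (∈-concatMap⁻ (prism zero-vec) {xs = sphere d} τ∈)
... | σ , σ∈ , τ∈′ with sphere-Flag d σ∈
...   | flag , len = prism-Flag σ (All.universal zero-⊑ σ) flag τ∈′ ,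
                    trans (prism-length zero-vec σ τ∈′) (cong suc len)

sphere-Flag zero    (here refl) = ([] , []) , refl
sphere-Flag (suc d) σ∈ with ∈-++⁻ (hemisphere (suc d)) σ∈
... | inj₁ σ∈H = hemisphere-Flag d σ∈H
... | inj₂ σ∈νH with ∈-map⁻ (map neg-vec) σ∈νH
...   | τ , τ∈ , refl with hemisphere-Flag d τ∈
...     | (⊑τ , τ≢0) , len =
  (AllPairs.map⁺ (AllPairs.map neg-mono ⊑τ) , All.map⁺ (All.map (λ {x} → Nonzero-neg {x = x}) τ≢0)) ,
  trans (length-map neg-vec τ) len

Antipodal : ∀ {d} → (SignVec d → Label) → Set
Antipodal ℓ = ∀ x → Nonzero x → ℓ (neg-vec x) ≡ opposite (ℓ x)

-- Ky Fan's parity count: modulo 2, the boundary of a hemisphere is the sphere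
-- of one dimension less, and positive is a cochain whose coboundary adds up
-- its values on a simplex and on the antipodal simplex.
fan : ∀ d (ℓ : SignVec d → Label) → Antipodal ℓ → ⨁ (positive ∘ map ℓ) (sphere d) ≡ true
fan zero    ℓ anti = refl
fan (suc d) ℓ anti = begin
  ⨁ g (sphere (suc d))                                    ≡⟨ ⨁-sphere g ⟩
  ⨁ g H xor ⨁ (g ∘ map neg-vec) H                         ≡⟨ ⨁-xor g (g ∘ map neg-vec) H ⟨
  ⨁ (λ τ → g τ xor g (map neg-vec τ)) H                   ≡⟨ ⨁-cong-∈ H step ⟨
  ⨁ (∂ g) H                                               ≡⟨ ∂-hemisphere d g ⟩
  ⨁ (g ∘ map 0∷_) (sphere d)
    ≡⟨ ⨁-cong (λ σ → cong positive (map-∘ σ)) (sphere d) ⟨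
  ⨁ (positive ∘ map (ℓ ∘ 0∷_)) (sphere d)                 ≡⟨ fan d (ℓ ∘ 0∷_) (λ x → anti (0∷ x)) ⟩
  true ∎
  where
  open ≡-Reasoning
  g = positive ∘ map ℓ
  H = hemisphere (suc d)
  map-anti : ∀ {τ} → All Nonzero τ → map opposite (map ℓ τ) ≡ map ℓ (map neg-vec τ)
  map-anti []          = refl
  map-anti (x≢0 ∷ τ≢0) = cong₂ _∷_ (sym (anti _ x≢0)) (map-anti τ≢0)
  step : ∀ {τ} → τ ∈ H → ∂ g τ ≡ g τ xor g (map neg-vec τ)
  step {τ} τ∈ with hemisphere-Flag d τ∈
  step {x ∷ τ} τ∈ | (_ , ≢0) , _ = begin
    ∂ g (x ∷ τ)                                           ≡⟨ ∂-map positive ℓ (x ∷ τ) ⟨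
    ∂ positive (map ℓ (x ∷ τ))                            ≡⟨ ∂-positive (ℓ x) (map ℓ τ) ⟩
    g (x ∷ τ) xor positive (map opposite (map ℓ (x ∷ τ)))
      ≡⟨ cong (λ l → g (x ∷ τ) xor positive l) (map-anti ≢0) ⟩
    g (x ∷ τ) xor g (map neg-vec (x ∷ τ))                 ∎

-- The odd count of `fan` provides a flag of n vectors whose sorted labels alternate; by
-- `alternating-bound` they would have n different magnitudes below `M`.
tucker : ∀ {n M} → M < n → (ℓ : SignVec n → Label) → Antipodal ℓ →
  (∀ x → Nonzero x → mag (ℓ x) < M) →
  ¬ (∀ {x y} → Nonzero x → Nonzero y → x ⊑ y → Compatible (ℓ x) (ℓ y))
tucker {n} {M} M<n ℓ anti <M compatible
  with ⨁-witness (positive ∘ map ℓ) (sphere n) (fan n ℓ anti)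
... | σ , σ∈ , alt with sphere-Flag n σ∈
...   | (⊑σ , σ≢0) , len =
  impossible (sort l) (trans (length-sort l) (trans (length-map ℓ σ) len)) (sort-sorted l)
    (sort-AllPairs (λ x~y m → sym (x~y (sym m))) (pairwise ⊑σ σ≢0))
    (sort-All (All.map⁺ (All.map (<M _) σ≢0))) alt
  where
  l = map ℓ σ
  pairwise : ∀ {σ} → AllPairs _⊑_ σ → All Nonzero σ → AllPairs Compatible (map ℓ σ)
  pairwise []        []          = []
  pairwise (x⊑ ∷ ⊑σ) (x≢0 ∷ σ≢0) =
    All.map⁺ (All.zipWith (λ (y≢0 , x⊑y) → compatible x≢0 y≢0 x⊑y) (σ≢0 , x⊑)) ∷ pairwise ⊑σ σ≢0
  impossible : ∀ τ → length τ ≡ n → Sorted τ → AllPairs Compatible τ → All (λ y → mag y < M) τ →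
               ¬ alternates true τ ≡ true
  impossible []      len _ _ _ _ with subst (M <_) (sym len) M<n
  ... | ()
  impossible (x ∷ τ) len ↗τ ~τ <M alt = <-irrefl refl (begin-strict
    M                        <⟨ M<n ⟩
    n                        ≡⟨ len ⟨
    length (x ∷ τ)           ≤⟨ m≤m+n (length (x ∷ τ)) (mag x) ⟩
    length (x ∷ τ) + mag x   ≤⟨ alternating-bound M true x τ ↗τ ~τ <M alt ⟩
    M                        ∎)
    where open ≤-Reasoning

-- Schrijver's theorem

IsVertex : ∀ {n} → ℕ → Subset n → Set
IsVertex k A = ∣ A ∣ ≡ k × Stable A

isVertex? : ∀ {n} k (A : Subset n) → Dec (IsVertex k A)
isVertex? k A = (∣ A ∣ ≟ k) ×-dec stable? A

∈-subsets : ∀ {n} (A : Subset n) → A ∈ subsets n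
∈-subsets Vec.[]              = here refl
∈-subsets (inside  Vec.∷ A) = ∈-++⁺ˡ (∈-map⁺ _ (∈-subsets A))
∈-subsets (outside Vec.∷ A) = ∈-++⁺ʳ (map (inside Vec.∷_) (subsets _)) (∈-map⁺ _ (∈-subsets A))

∈-stableSubsets⁺ : ∀ {n k} {A : Subset n} → IsVertex k A → A ∈ stableSubsets n k
∈-stableSubsets⁺ {k = k} = ∈-filter⁺ (isVertex? k) (∈-subsets _)

∈-stableSubsets⁻ : ∀ {n k} {A : Subset n} → A ∈ stableSubsets n k → IsVertex k A
∈-stableSubsets⁻ {n} {k} = proj₂ ∘ ∈-filter⁻ (isVertex? k) {xs = subsets n}

-- Spread t b A: A has no two neighbours, and not its first element if b,
-- and its last element only if t.
Spread : Bool → Bool → ∀ {n} → Subset n → Set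
Spread t b     Vec.[]              = t ≡ true ⊎ b ≡ false
Spread t b     (outside Vec.∷ A) = Spread t false A
Spread t true  (inside  Vec.∷ A) = Void
Spread t false (inside  Vec.∷ A) = Spread t true A

Spread-weaken : ∀ t {n} (A : Subset n) → Spread t true A → Spread t false A
Spread-weaken t Vec.[]              _  = inj₂ refl
Spread-weaken t (outside Vec.∷ A) sp = sp

Spread-∅ : ∀ t n → Spread t false (∅ {n})
Spread-∅ t zero    = inj₂ refl
Spread-∅ t (suc n) = Spread-∅ t n

spread-first : ∀ t {n} (A : Subset n) {i} → Spread t true A → i ∈ₛ A → toℕ i ≢ 0
spread-first t (outside Vec.∷ A) {suc i} sp i∈ ()

spread-last : ∀ b {n} (A : Subset n) {i} → Spread false b A → i ∈ₛ A → suc (toℕ i) ≢ n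
spread-last false (inside Vec.∷ Vec.[]) (inj₁ ()) Vec.here _
spread-last false (inside Vec.∷ Vec.[]) (inj₂ ()) Vec.here _
spread-last false (inside Vec.∷ (_ Vec.∷ _)) sp Vec.here ()
spread-last b     (outside Vec.∷ A) sp (Vec.there i∈) eq = spread-last false A sp i∈ (suc-injective eq)
spread-last false (inside Vec.∷ A)  sp (Vec.there i∈) eq = spread-last true A sp i∈ (suc-injective eq)

spread-step : ∀ t b {n} (A : Subset n) {i j} → Spread t b A → i ∈ₛ A → j ∈ₛ A → toℕ j ≢ suc (toℕ i)
spread-step t false (inside Vec.∷ A) sp Vec.here (Vec.there j∈) eq =
  spread-first t A sp j∈ (suc-injective eq)
spread-step t b (outside Vec.∷ A) sp (Vec.there i∈) (Vec.there j∈) eq =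
  spread-step t false A sp i∈ j∈ (suc-injective eq)
spread-step t false (inside Vec.∷ A) sp (Vec.there i∈) (Vec.there j∈) eq =
  spread-step t true A sp i∈ j∈ (suc-injective eq)

-- A wrap-around pair consists of the last and the first element. Equal flags exclude one of them:
-- the first if both are true, the last if both are false.
spread⇒stable : ∀ b {n} (A : Subset n) → Spread b b A → Stable A
spread⇒stable b     A sp i j i∈ j∈ (inj₁ eq)        = spread-step b b A sp i∈ j∈ eq
spread⇒stable true  A sp i j i∈ j∈ (inj₂ (_ , eq))  = spread-first true A sp j∈ eq
spread⇒stable false A sp i j i∈ j∈ (inj₂ (eq , _))  = spread-last false A sp i∈ eq

-- Stable sets inside one sign of a vector

Within : ∀ {n} → Bool → Subset n → SignVec n → Set
Within s A x = ∀ i → i ∈ₛ A → lookup x i ≡ just s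

within? : ∀ {n} s (A : Subset n) x → Dec (Within s A x)
within? s A x = all? λ i → (i ∈? A) →-dec Maybe.≡-dec _≟ᵇ_ (lookup x i) (just s)

within-outside : ∀ {n s a} {A : Subset n} {x} → Within s A x → Within s (outside Vec.∷ A) (a Vec.∷ x)
within-outside w (suc i) (Vec.there i∈) = w i i∈

within-inside : ∀ {n s} {A : Subset n} {x} → Within s A x → Within s (inside Vec.∷ A) (just s Vec.∷ x)
within-inside w zero    Vec.here       = refl
within-inside w (suc i) (Vec.there i∈) = w i i∈

within-neg : ∀ {n s} {A : Subset n} {x} → Within s A x → Within (not s) A (neg-vec x)
within-neg {x = x} w i i∈ = trans (lookup-map i (Maybe.map not) x) (cong (Maybe.map not) (w i i∈))

within-mono : ∀ {n s} {A : Subset n} {x y} → x ⊑ y → Within s A x → Within s A y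
within-mono {s = s} x⊑y w i i∈ = lemma (Pointwise.lookup x⊑y i) (w i i∈)
  where
  lemma : ∀ {a b : Maybe Bool} → a ≡ nothing ⊎ a ≡ b → a ≡ just s → b ≡ just s
  lemma (inj₁ refl) ()
  lemma (inj₂ refl) eq = eq

within-disjoint : ∀ {n} {A B : Subset n} {x} → Within true A x → Within false B x → Empty (A ∩ B)
within-disjoint {A = A} {B} w w′ (i , i∈) with x∈p∩q⁻ A B i∈
... | i∈A , i∈B with trans (sym (w i i∈A)) (w′ i i∈B)
...   | ()

changes-same : ∀ {n} b (x : SignVec n) → changes b (just b Vec.∷ x) ≡ changes b x
changes-same true  x = refl
changes-same false x = refl

changes-flip : ∀ {n} b (x : SignVec n) → changes (not b) (just b Vec.∷ x) ≡ suc (changes b x)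
changes-flip true  x = refl
changes-flip false x = refl

changes-flip′ : ∀ {n} b (x : SignVec n) → changes b (just (not b) Vec.∷ x) ≡ suc (changes (not b) x)
changes-flip′ true  x = refl
changes-flip′ false x = refl

changes-≤ : ∀ {n} b c (x : SignVec n) → changes b x ≤ suc (changes c x)
changes-≤ b c Vec.[] = z≤n
changes-≤ b c (nothing Vec.∷ x) = changes-≤ b c x
changes-≤ true  true  (just true  Vec.∷ x) = n≤1+n _
changes-≤ true  true  (just false Vec.∷ x) = n≤1+n _
changes-≤ true  false (just true  Vec.∷ x) = ≤-trans (n≤1+n _) (n≤1+n _)
changes-≤ true  false (just false Vec.∷ x) = ≤-refl
changes-≤ false true  (just true  Vec.∷ x) = ≤-refl
changes-≤ false true  (just false Vec.∷ x) = ≤-trans (n≤1+n _) (n≤1+n _)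
changes-≤ false false (just true  Vec.∷ x) = n≤1+n _
changes-≤ false false (just false Vec.∷ x) = n≤1+n _

changes-mono : ∀ {n} b {x y : SignVec n} → x ⊑ y → changes b x ≤ changes b y
changes-mono b [] = z≤n
changes-mono b {x = nothing Vec.∷ x} {nothing Vec.∷ y} (_ ∷ xy) = changes-mono b xy
changes-mono b {x = nothing Vec.∷ x} {just c Vec.∷ y} (_ ∷ xy) with c ≟ᵇ b
... | yes refl rewrite changes-same b y = changes-mono b xy
... | no  c≢b rewrite ¬-not c≢b | changes-flip′ b y =
        ≤-trans (changes-≤ b (not b) x) (s≤s (changes-mono (not b) xy))
changes-mono true  {x = just true  Vec.∷ x} (inj₂ refl ∷ xy) = changes-mono true xy
changes-mono true  {x = just false Vec.∷ x} (inj₂ refl ∷ xy) = s≤s (changes-mono false xy)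
changes-mono false {x = just true  Vec.∷ x} (inj₂ refl ∷ xy) = s≤s (changes-mono true xy)
changes-mono false {x = just false Vec.∷ x} (inj₂ refl ∷ xy) = changes-mono false xy

-- If the last element of the ground set may be chosen, no sign change has to follow the k-th run,
-- which saves one change.
slack : Bool → ℕ
slack true  = 1
slack false = 0

Selection : Bool → Bool → Bool → ℕ → ∀ {n} → SignVec n → Set
Selection s t b k {n} x = Σ (Subset n) λ A → ∣ A ∣ ≡ k × Spread t b A × Within s A x

skip : ∀ {s t b k a n} {x : SignVec n} → Selection s t false k x → Selection s t b k (a Vec.∷ x)
skip {b = b} (A , size , sp , w) = outside Vec.∷ A , size , sp , within-outside w

unblock : ∀ {s t k n} {x : SignVec n} → Selection s t true k x → Selection s t false k x
unblock {t = t} (A , size , sp , w) = A , size , Spread-weaken t A sp , w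

take : ∀ {s t k n} {x : SignVec n} → Selection s t true k x →
  Selection s t false (suc k) (just s Vec.∷ x)
take (A , size , sp , w) = inside Vec.∷ A , cong suc size , sp , within-inside w

-- The first elements of k runs of the sign s; the runs of the opposite sign
-- keep them apart.
ready   : ∀ s t k {n} (x : SignVec n) → 2 * k ≤ changes (not s) x + slack t → Selection s t false k x
blocked : ∀ s t k {n} (x : SignVec n) → suc (2 * k) ≤ changes s x + slack t → Selection s t true k x

ready s t zero {n} x _ = ∅ , ∣⊥∣≡0 n , Spread-∅ t n , λ i i∈ → void (∉⊥ i∈)
ready s true  (suc k) Vec.[] (s≤s le) with subst (_≤ 0) (+-suc k (k + 0)) le
... | ()
ready s t (suc k) (nothing Vec.∷ x) le = skip {x = x} (ready s t (suc k) x le)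
ready s t (suc k) (just c Vec.∷ x) le with c ≟ᵇ s
... | yes refl = take {x = x} (blocked s t k x (s≤s⁻¹ (begin
        suc (suc (2 * k))               ≡⟨ *-suc 2 k ⟨
        2 * suc k                       ≤⟨ le ⟩
        changes (not s) (just s Vec.∷ x) + slack t  ≡⟨ cong (_+ slack t) (changes-flip s x) ⟩
        suc (changes s x + slack t)     ∎)))
  where open ≤-Reasoning
... | no c≢s rewrite ¬-not c≢s | changes-same (not s) x = skip {x = x} (ready s t (suc k) x le)

blocked s true  zero    Vec.[] le = Vec.[] , refl , inj₁ refl , λ ()
blocked s true  (suc k) Vec.[] (s≤s ())
blocked s t k (nothing Vec.∷ x) le = skip {x = x} (unblock {x = x} (blocked s t k x le))
blocked s t k (just c Vec.∷ x) le with c ≟ᵇ s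
... | yes refl rewrite changes-same s x = skip {x = x} (unblock {x = x} (blocked s t k x le))
... | no c≢s rewrite ¬-not c≢s | changes-flip′ s x = skip {x = x} (ready s t k x (s≤s⁻¹ le))

-- The bound says that x has an alternating subsequence of 2 k signs. If a sign change follows the
-- k-th run of `s`, the last element of the ground set is avoided. Otherwise the count is tight, the
-- first nonzero sign is opposite to `s`, and the first element is avoided instead.
vertex-within : ∀ k {n} (x : SignVec n) → Nonzero x → 2 * k ≤ suc (changes true x ⊓ changes false x) →
                ∀ s → ∃ λ A → IsVertex k A × Within s A x
vertex-within k x x≢0 large s with 2 * k ≤? changes (not s) x
... | yes le with ready s false k x (≤-trans le (m≤m+n _ _))
...   | A , size , sp , w = A , (size , spread⇒stable false A sp) , w
vertex-within k x x≢0 large s | no ≰ with blocked s true k x (begin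
        suc (2 * k)          ≤⟨ ≤∧≢⇒< (large′ s) (λ eq → differ s (suc-injective
                                  (trans (sym eq) (≤-antisym (large′ (not s)) (≰⇒> ≰))))) ⟩
        suc (changes s x)    ≡⟨ +-comm 1 (changes s x) ⟩
        changes s x + 1      ∎)
  where
  open ≤-Reasoning
  large′ : ∀ s → 2 * k ≤ suc (changes s x)
  large′ true  = ≤-trans large (s≤s (m⊓n≤m _ _))
  large′ false = ≤-trans large (s≤s (m⊓n≤n (changes true x) _))
  differ : ∀ s → changes s x ≢ changes (not s) x
  differ true  = x≢0
  differ false = x≢0 ∘ sym
...   | A , size , sp , w = A , (size , spread⇒stable true A sp) , w

-- The labelling induced by a colouring

module _ {A : Set} {P : A → Set} (P? : ∀ a → Dec (P a)) (f : A → ℕ) where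

  maxOn : List A → ℕ
  maxOn []       = 0
  maxOn (a ∷ as) with P? a
  ... | yes _ = f a ⊔ maxOn as
  ... | no  _ = maxOn as

  maxOn-upper : ∀ {a as} → a ∈ as → P a → f a ≤ maxOn as
  maxOn-upper {as = b ∷ as} (here refl) pa with P? b
  ... | yes _  = m≤m⊔n (f b) _
  ... | no ¬pa = contradiction pa ¬pa
  maxOn-upper {as = b ∷ as} (there a∈) pa with P? b
  ... | yes _  = ≤-trans (maxOn-upper a∈ pa) (m≤n⊔m (f b) _)
  ... | no _   = maxOn-upper a∈ pa

  maxOn-attained : ∀ as → 1 ≤ maxOn as → ∃ λ a → a ∈ as × P a × f a ≡ maxOn as
  maxOn-attained (a ∷ as) 1≤b with P? a
  ... | no  _ with maxOn-attained as 1≤b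
  ...   | b , b∈ , pb , eq = b , there b∈ , pb , eq
  maxOn-attained (a ∷ as) 1≤b | yes pa with ⊔-sel (f a) (maxOn as)
  ... | inj₁ eq = a , here refl , pa , sym eq
  ... | inj₂ eq with maxOn-attained as (subst (1 ≤_) eq 1≤b)
  ...   | b , b∈ , pb , eq′ = b , there b∈ , pb , trans eq′ (sym eq)

  maxOn-least : ∀ {c} as → (∀ {a} → a ∈ as → P a → f a ≤ c) → maxOn as ≤ c
  maxOn-least []       bound = z≤n
  maxOn-least (a ∷ as) bound with P? a
  ... | yes pa = ⊔-lub (bound (here refl) pa) (maxOn-least as (bound ∘ there))
  ... | no  _  = maxOn-least as (bound ∘ there)

infix 8 _≺_

_≺_ : ℕ → ℕ → Bool
a ≺ b with a <? b
... | yes _ = true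
... | no  _ = false

≺-flip : ∀ {a b} → a ≢ b → (b ≺ a) ≡ not ((a ≺ b))
≺-flip {a} {b} a≢b with b <? a | a <? b
... | yes b<a | yes a<b = contradiction a<b (<-asym b<a)
... | yes _   | no  _   = refl
... | no  _   | yes _   = refl
... | no  b≮a | no  a≮b = contradiction (≤-antisym (≮⇒≥ b≮a) (≮⇒≥ a≮b)) a≢b

-- Here p and m count the changes after a leading plus and minus, q is their minimum, and a and b
-- are the largest colours in the positive and the negative part. Few changes give the magnitudes 0
-- to 2 k - 2. Otherwise a and b are distinct and positive, so their maximum lies between 2 and c,
-- and subtracting 3 places the magnitudes from 2 k - 1 to 2 k + c - 3 directly above.
label′ : ℕ → ℕ → ℕ → ℕ → ℕ → ℕ → Label
label′ k q p m a b with 2 * k ≤? suc q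
... | yes _ = (b ≺ a) , 2 * k + (a ⊔ b) ∸ 3
... | no  _ = (p ≺ m) , q

label′-flip : ∀ k q p m a b → p ≢ m → (2 * k ≤ suc q → a ≢ b) →
              label′ k q m p b a ≡ opposite (label′ k q p m a b)
label′-flip k q p m a b p≢m a≢b with 2 * k ≤? suc q
... | yes large = cong₂ _,_ (≺-flip (a≢b large ∘ sym)) (cong (λ e → 2 * k + e ∸ 3) (⊔-comm b a))
... | no  _     = cong (_, q) (≺-flip p≢m)

distinct⇒2≤⊔ : ∀ {a b} → 1 ≤ a → 1 ≤ b → a ≢ b → 2 ≤ a ⊔ b
distinct⇒2≤⊔ {a} {b} 1≤a 1≤b a≢b with 2 ≤? a | 2 ≤? b
... | yes 2≤a | _       = ≤-trans 2≤a (m≤m⊔n a b)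
... | no _    | yes 2≤b = ≤-trans 2≤b (m≤n⊔m a b)
... | no 2≰a  | no 2≰b  = contradiction
  (trans (≤-antisym (s≤s⁻¹ (≰⇒> 2≰a)) 1≤a) (sym (≤-antisym (s≤s⁻¹ (≰⇒> 2≰b)) 1≤b))) a≢b

-- If the minimum changed sides, the larger of the first two counts would be at most the common
-- minimum, by monotonicity.
small-compatible : ∀ {p m p′ m′} → p ≢ m → p′ ≢ m′ → p ≤ p′ → m ≤ m′ → p ⊓ m ≡ p′ ⊓ m′ →
                   (p ≺ m) ≡ (p′ ≺ m′)
small-compatible {p} {m} {p′} {m′} p≢m p′≢m′ p≤p′ m≤m′ eq with p <? m | p′ <? m′
... | yes _   | yes _     = refl
... | no  _   | no  _     = refl
... | yes p<m | no  p′≮m′ = contradiction (begin-strict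
  p          <⟨ p<m ⟩
  m          ≤⟨ m≤m′ ⟩
  m′         ≡⟨ m≥n⇒m⊓n≡n (≮⇒≥ p′≮m′) ⟨
  p′ ⊓ m′    ≡⟨ eq ⟨
  p ⊓ m      ≤⟨ m⊓n≤m p m ⟩
  p          ∎) (<-irrefl refl)
  where open ≤-Reasoning
... | no  p≮m | yes p′<m′ = contradiction (begin-strict
  m          <⟨ ≤∧≢⇒< (≮⇒≥ p≮m) (p≢m ∘ sym) ⟩
  p          ≤⟨ p≤p′ ⟩
  p′         ≡⟨ m≤n⇒m⊓n≡m (<⇒≤ p′<m′) ⟨
  p′ ⊓ m′    ≡⟨ eq ⟨
  p ⊓ m      ≤⟨ m⊓n≤n p m ⟩
  m          ∎) (<-irrefl refl)
  where open ≤-Reasoning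

-- A common maximum attained on opposite sides would be one colour of two sets in opposite parts of
-- comparable vectors. Such sets are disjoint, which is where the two inequalities come from.
large-compatible : ∀ {a b a′ b′} → a ≢ b′ → b ≢ a′ → a ⊔ b ≡ a′ ⊔ b′ → (b ≺ a) ≡ (b′ ≺ a′)
large-compatible {a} {b} {a′} {b′} a≢b′ b≢a′ eq with b <? a | b′ <? a′
... | yes _   | yes _     = refl
... | no  _   | no  _     = refl
... | yes b<a | no  b′≮a′ =
  contradiction (trans (sym (m≥n⇒m⊔n≡m (<⇒≤ b<a))) (trans eq (m≤n⇒m⊔n≡n (≮⇒≥ b′≮a′)))) a≢b′
... | no  b≮a | yes b′<a′ =
  contradiction (trans (sym (m≤n⇒m⊔n≡n (≮⇒≥ b≮a))) (trans eq (m≥n⇒m⊔n≡m (<⇒≤ b′<a′)))) b≢a′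

label′-cong : ∀ k {q q′ p p′ m m′ a a′ b b′} → q ≡ q′ → p ≡ p′ → m ≡ m′ → a ≡ a′ → b ≡ b′ →
              label′ k q p m a b ≡ label′ k q′ p′ m′ a′ b′
label′-cong k refl refl refl refl refl = refl

2k+-∸3 : ∀ k {e} → 1 ≤ k → 2 ≤ e → 3 + (2 * k + e ∸ 3) ≡ 2 * k + e
2k+-∸3 k {e} 1≤k 2≤e = m+[n∸m]≡n (≤-trans (n≤1+n 3) (+-mono-≤ (*-monoʳ-≤ 2 1≤k) 2≤e))

label′-small : ∀ k {n c q p m} a b → 1 ≤ k → 1 ≤ c → c + 2 * k ≡ suc (suc n) →
  (2 * k ≤ suc q → 2 ≤ a ⊔ b) → (2 * k ≤ suc q → a ⊔ b ≤ c) → mag (label′ k q p m a b) < n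
label′-small k {n} {c} {q} a b 1≤k 1≤c c+2k 2≤ ≤c with 2 * k ≤? suc q
... | yes large = s≤s⁻¹ (s≤s⁻¹ (begin
  3 + (2 * k + (a ⊔ b) ∸ 3)  ≡⟨ 2k+-∸3 k 1≤k (2≤ large) ⟩
  2 * k + (a ⊔ b)            ≤⟨ +-monoʳ-≤ (2 * k) (≤c large) ⟩
  2 * k + c                  ≡⟨ +-comm (2 * k) c ⟩
  c + 2 * k                  ≡⟨ c+2k ⟩
  suc (suc n)                ∎))
  where open ≤-Reasoning
... | no ¬large = s≤s⁻¹ (s≤s⁻¹ (begin
  suc (suc (suc q))          ≤⟨ s≤s (≰⇒> ¬large) ⟩
  1 + 2 * k                  ≤⟨ +-monoˡ-≤ (2 * k) 1≤c ⟩
  c + 2 * k                  ≡⟨ c+2k ⟩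
  suc (suc n)                ∎))
  where open ≤-Reasoning

large≢small : ∀ k {e q} → 1 ≤ k → 2 ≤ e → ¬ 2 * k ≤ suc q → 2 * k + e ∸ 3 ≢ q
large≢small k {e} {q} 1≤k 2≤e ¬large eq = ¬large (s≤s⁻¹ (s≤s⁻¹ (begin
  2 + 2 * k                ≡⟨ +-comm 2 (2 * k) ⟩
  2 * k + 2                ≤⟨ +-monoʳ-≤ (2 * k) 2≤e ⟩
  2 * k + e                ≡⟨ 2k+-∸3 k 1≤k 2≤e ⟨
  3 + (2 * k + e ∸ 3)      ≡⟨ cong (3 +_) eq ⟩
  3 + q                    ∎)))
  where open ≤-Reasoning

label′-compatible : ∀ k {q p m q′ p′ m′} a b a′ b′ → 1 ≤ k →
  (2 * k ≤ suc q → 2 ≤ a ⊔ b) → (2 * k ≤ suc q′ → 2 ≤ a′ ⊔ b′) →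
  (q ≡ q′ → (p ≺ m) ≡ (p′ ≺ m′)) →
  (2 * k ≤ suc q → 2 * k ≤ suc q′ → a ⊔ b ≡ a′ ⊔ b′ → (b ≺ a) ≡ (b′ ≺ a′)) →
  Compatible (label′ k q p m a b) (label′ k q′ p′ m′ a′ b′)
label′-compatible k {q} {q′ = q′} a b a′ b′ 1≤k 2≤ 2≤′ small large with 2 * k ≤? suc q | 2 * k ≤? suc q′
... | no  _ | no  _  = small
... | yes l | no ¬l′ = λ eq → contradiction eq (large≢small k 1≤k (2≤ l) ¬l′)
... | no ¬l | yes l′ = λ eq → contradiction (sym eq) (large≢small k 1≤k (2≤′ l′) ¬l)
... | yes l | yes l′ = λ eq → large l l′ (+-cancelˡ-≡ (2 * k) _ _
      (trans (sym (2k+-∸3 k 1≤k (2≤ l))) (trans (cong (3 +_) eq) (2k+-∸3 k 1≤k (2≤′ l′)))))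

module _ {n k c : ℕ} (1≤k : 1 ≤ k) (1≤c : 1 ≤ c) (c+2k : c + 2 * k ≡ suc (suc n))
         (colour : Subset (suc n) → ℕ)
         (colour-range : ∀ A → IsVertex k A → 1 ≤ colour A × colour A ≤ c)
         (colour-proper : ∀ A B → IsVertex k A → IsVertex k B → Empty (A ∩ B) → colour A ≢ colour B)
         where

  private
    best : Bool → SignVec (suc n) → ℕ
    best s x = maxOn (λ A → within? s A x) colour (stableSubsets (suc n) k)

    best-attained : ∀ s x → 1 ≤ best s x → ∃ λ A → IsVertex k A × Within s A x × colour A ≡ best s x
    best-attained s x 1≤b with maxOn-attained (λ A → within? s A x) colour (stableSubsets (suc n) k) 1≤b
    ... | A , A∈ , w , eq = A , ∈-stableSubsets⁻ A∈ , w , eq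

    best-≤ : ∀ s x → best s x ≤ c
    best-≤ s x = maxOn-least (λ A → within? s A x) colour (stableSubsets (suc n) k)
      λ A∈ _ → proj₂ (colour-range _ (∈-stableSubsets⁻ A∈))

    best-neg-≤ : ∀ s x → best s x ≤ best (not s) (neg-vec x)
    best-neg-≤ s x = maxOn-least (λ A → within? s A x) colour (stableSubsets (suc n) k)
      λ {A} A∈ w → maxOn-upper (λ A → within? (not s) A (neg-vec x)) colour A∈ (within-neg {A = A} {x} w)

    best-neg : ∀ s x → best (not s) (neg-vec x) ≡ best s x
    best-neg s x = ≤-antisym (begin
      best (not s) (neg-vec x)                        ≤⟨ best-neg-≤ (not s) (neg-vec x) ⟩
      best (not (not s)) (neg-vec (neg-vec x))
        ≡⟨ cong₂ best (not-involutive s) (neg-vec-involutive x) ⟩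
      best s x                                        ∎) (best-neg-≤ s x)
      where open ≤-Reasoning

    Large : SignVec (suc n) → Set
    Large x = 2 * k ≤ suc (changes true x ⊓ changes false x)

    best-positive : ∀ x → Nonzero x → Large x → ∀ s → 1 ≤ best s x
    best-positive x x≢0 large s with vertex-within k x x≢0 large s
    ... | A , vA , w = ≤-trans (proj₁ (colour-range A vA))
                               (maxOn-upper (λ A → within? s A x) colour (∈-stableSubsets⁺ vA) w)

    best-distinct′ : ∀ x y → x ⊑ y → 1 ≤ best true x → 1 ≤ best false y → best true x ≢ best false y
    best-distinct′ x y x⊑y 1≤b 1≤b′ eq with best-attained true x 1≤b | best-attained false y 1≤b′
    ... | A , vA , w , ≡A | B , vB , w′ , ≡B =
      colour-proper A B vA vB (within-disjoint {A = A} {B} {y} (within-mono {A = A} x⊑y w) w′)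
        (trans ≡A (trans eq (sym ≡B)))

    best-distinct″ : ∀ x y → x ⊑ y → 1 ≤ best false x → 1 ≤ best true y → best false x ≢ best true y
    best-distinct″ x y x⊑y 1≤b 1≤b′ eq with best-attained false x 1≤b | best-attained true y 1≤b′
    ... | A , vA , w , ≡A | B , vB , w′ , ≡B =
      colour-proper B A vB vA (within-disjoint {A = B} {A} {y} w′ (within-mono {A = A} x⊑y w))
        (trans ≡B (trans (sym eq) (sym ≡A)))

    best-distinct : ∀ x → Nonzero x → Large x → best true x ≢ best false x
    best-distinct x x≢0 large =
      best-distinct′ x x ⊑-refl (best-positive x x≢0 large true) (best-positive x x≢0 large false)

    label : SignVec (suc n) → Label
    label x = label′ k (changes true x ⊓ changes false x) (changes true x) (changes false x)
                     (best true x) (best false x)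

    label-antipodal : Antipodal label
    label-antipodal x x≢0 = trans
      (label′-cong k (trans (cong₂ _⊓_ (changes-neg false x) (changes-neg true x))
                            (⊓-comm (changes false x) (changes true x)))
                     (changes-neg false x) (changes-neg true x) (best-neg false x) (best-neg true x))
      (label′-flip k _ _ _ _ _ x≢0 (best-distinct x x≢0))

    2≤best : ∀ x → Nonzero x → Large x → 2 ≤ best true x ⊔ best false x
    2≤best x x≢0 large = distinct⇒2≤⊔ (best-positive x x≢0 large true) (best-positive x x≢0 large false)
                                      (best-distinct x x≢0 large)

    label-small : ∀ x → Nonzero x → mag (label x) < n
    label-small x x≢0 = label′-small k (best true x) (best false x) 1≤k 1≤c c+2k (2≤best x x≢0)
      λ _ → ⊔-lub (best-≤ true x) (best-≤ false x)

    label-compatible : ∀ {x y} → Nonzero x → Nonzero y → x ⊑ y → Compatible (label x) (label y)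
    label-compatible {x} {y} x≢0 y≢0 x⊑y = label′-compatible k (best true x) _ (best true y) _ 1≤k
      (2≤best x x≢0) (2≤best y y≢0)
      (small-compatible x≢0 y≢0 (changes-mono true x⊑y) (changes-mono false x⊑y))
      λ lx ly → large-compatible
        (best-distinct′ x y x⊑y (best-positive x x≢0 lx true) (best-positive y y≢0 ly false))
        (best-distinct″ x y x⊑y (best-positive x x≢0 lx false) (best-positive y y≢0 ly true))

  schrijver : Void
  -- The ground set has n + 1 elements, so vectors of length n + 1 receive only n magnitudes: 2 k +
  -- c - 3 equals n - 1.
  schrijver = tucker (n<1+n n) label label-antipodal label-small label-compatible

-- Frege proofs with a bounded number of lines

module _ {V : Set} {Γ : List (Formula V)} where

  _++ᵖ_ : ∀ {ls ms} → Proof Γ ls → Proof Γ ms → Proof Γ (ls ++ ms)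
  []          ++ᵖ ρ = ρ
  hyp A∈ π    ++ᵖ ρ = hyp A∈ (π ++ᵖ ρ)
  axiom a π   ++ᵖ ρ = axiom a (π ++ᵖ ρ)
  mp A⇒B A π  ++ᵖ ρ = mp (∈-++⁺ˡ A⇒B) (∈-++⁺ˡ A) (π ++ᵖ ρ)

-- A hypothesis that is already a line of `ls₀` is pointed to and not copied. So a derived
-- hypothesis is paid for once, however often it is used, and cuts become additive.
substProof : ∀ {V} {Γ Δ : List (Formula V)} {ls₀} → Proof Γ ls₀ → (∀ {A} → A ∈ Δ → A ∈ ls₀ ⊎ A ∈ Γ) →
  ∀ {ls} → Proof Δ ls → ∃ λ ms → Proof Γ (ms ++ ls₀) × ls ⊆ ms ++ ls₀ × length ms ≤ length ls
substProof π₀ σ [] = [] , π₀ , (λ ()) , z≤n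
substProof π₀ σ (hyp A∈ π) with σ A∈ | substProof π₀ σ π
... | inj₁ A∈₀ | ms , ρ , sub , short =
  ms , ρ , (λ { (here refl) → ∈-++⁺ʳ ms A∈₀ ; (there B∈) → sub B∈ }) , ≤-trans short (n≤1+n _)
... | inj₂ A∈Γ | ms , ρ , sub , short =
  _ ∷ ms , hyp A∈Γ ρ , (λ { (here refl) → here refl ; (there B∈) → there (sub B∈) }) , s≤s short
substProof π₀ σ (axiom a π) with substProof π₀ σ π
... | ms , ρ , sub , short =
  _ ∷ ms , axiom a ρ , (λ { (here refl) → here refl ; (there B∈) → there (sub B∈) }) , s≤s short
substProof π₀ σ (mp A⇒B A π) with substProof π₀ σ π
... | ms , ρ , sub , short =
  _ ∷ ms , mp (sub A⇒B) (sub A) ρ ,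
  (λ { (here refl) → here refl ; (there B∈) → there (sub B∈) }) , s≤s short

module _ {V : Set} {Γ : List (Formula V)} (A : Formula V) where

  private
    Discharged : List (Formula V) → Set
    Discharged ls = ∃ λ ms → Proof Γ ms × (∀ {B} → B ∈ ls → (A ⇒ B) ∈ ms) × length ms ≤ 5 * length ls

    appendLines : ∀ {B ls} (π : Discharged ls) ms → length ms ≤ 4 → Proof Γ ((A ⇒ B) ∷ ms ++ proj₁ π) →
      Discharged (B ∷ ls)
    appendLines {B} {ls} (ns , _ , sub , short) ms ms≤4 ρ = _ , ρ , member , bound
      where
      member : ∀ {C} → C ∈ B ∷ ls → (A ⇒ C) ∈ (A ⇒ B) ∷ ms ++ ns
      member (here refl) = here refl
      member (there C∈)  = there (∈-++⁺ʳ ms (sub C∈))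
      bound : suc (length (ms ++ ns)) ≤ 5 * suc (length ls)
      bound = ≤-trans (s≤s (≤-reflexive (length-++ ms)))
                      (≤-trans (+-mono-≤ (s≤s ms≤4) short) (≤-reflexive (sym (*-suc 5 (length ls)))))

    weakened : ∀ {B ls} (π : Discharged ls) → Proof Γ (B ∷ proj₁ π) → Discharged (B ∷ ls)
    weakened {B} π ρ = appendLines π ((B ⇒ A ⇒ B) ∷ B ∷ []) (m≤m+n 2 2)
      (mp (here refl) (there (here refl)) (axiom (K B A) ρ))

  -- The deduction theorem. Each line becomes an implication with at most four auxiliary lines; the
  -- worst case is the discharged hypothesis itself, through the usual proof of `A ⇒ A`. This factor
  -- is the origin of the condition `5 ≤ B` below.
  discharge : ∀ {ls} → Proof (A ∷ Γ) ls →
    ∃ λ ms → Proof Γ ms × (∀ {B} → B ∈ ls → (A ⇒ B) ∈ ms) × length ms ≤ 5 * length ls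
  discharge [] = [] , [] , (λ ()) , z≤n
  discharge (hyp (here refl) π) = appendLines (discharge π)
    (((A ⇒ A ⇒ A) ⇒ A ⇒ A) ∷ (A ⇒ A ⇒ A) ∷ (A ⇒ (A ⇒ A) ⇒ A) ∷ ((A ⇒ (A ⇒ A) ⇒ A) ⇒ (A ⇒ A ⇒ A) ⇒ A ⇒ A)
      ∷ [])
    ≤-refl
    (mp (here refl) (there (here refl))
    (mp (there (there (here refl))) (there (here refl))
    (axiom (K A A) (axiom (K A (A ⇒ A)) (axiom (S A (A ⇒ A) A) (proj₁ (proj₂ (discharge π))))))))
  discharge (hyp (there B∈Γ) π) = weakened (discharge π) (hyp B∈Γ (proj₁ (proj₂ (discharge π))))
  discharge (axiom a π) = weakened (discharge π) (axiom a (proj₁ (proj₂ (discharge π))))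
  discharge (mp {C} {B} C⇒B∈ C∈ π) = appendLines (discharge π)
    (((A ⇒ C) ⇒ A ⇒ B) ∷ ((A ⇒ C ⇒ B) ⇒ (A ⇒ C) ⇒ A ⇒ B) ∷ []) (m≤m+n 2 2)
    (mp (here refl) (there (there (sub C∈)))
    (mp (here refl) (there (sub C⇒B∈))
    (axiom (S A C B) ρ)))
    where
    ρ   = proj₁ (proj₂ (discharge π))
    sub = proj₁ (proj₂ (proj₂ (discharge π)))

-- Derivability with explicit line bounds

infix 3 _⊢⟨_⟩_

record _⊢⟨_⟩_ {V : Set} (Γ : List (Formula V)) (s : ℕ) (A : Formula V) : Set where
  constructor derivation
  field
    {lines} : List (Formula V)
    proof   : Proof Γ lines
    derives : A ∈ lines
    short   : length lines ≤ s

hypᵇ : ∀ {V} {Γ : List (Formula V)} {A} → A ∈ Γ → Γ ⊢⟨ 1 ⟩ A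
hypᵇ A∈ = derivation (hyp A∈ []) (here refl) ≤-refl

axiomᵇ : ∀ {V} {Γ : List (Formula V)} {A} → Axiom A → Γ ⊢⟨ 1 ⟩ A
axiomᵇ a = derivation (axiom a []) (here refl) ≤-refl

mpᵇ : ∀ {V} {Γ : List (Formula V)} {s t A B} → Γ ⊢⟨ s ⟩ A ⇒ B → Γ ⊢⟨ t ⟩ A → Γ ⊢⟨ suc (s + t) ⟩ B
mpᵇ (derivation {ls} π A⇒B∈ l) (derivation ρ A∈ m) = derivation
  (mp (∈-++⁺ˡ A⇒B∈) (∈-++⁺ʳ ls A∈) (π ++ᵖ ρ)) (here refl)
  (s≤s (≤-trans (≤-reflexive (length-++ ls)) (+-mono-≤ l m)))

⇒Iᵇ : ∀ {V} {Γ : List (Formula V)} {s A B} → A ∷ Γ ⊢⟨ s ⟩ B → Γ ⊢⟨ 5 * s ⟩ A ⇒ B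
⇒Iᵇ (derivation π B∈ l) with discharge _ π
... | _ , ρ , sub , m = derivation ρ (sub B∈) (≤-trans m (*-monoʳ-≤ 5 l))

relax : ∀ {V} {Γ : List (Formula V)} {s t A} → s ≤ t → Γ ⊢⟨ s ⟩ A → Γ ⊢⟨ t ⟩ A
relax s≤t (derivation π A∈ l) = derivation π A∈ (≤-trans l s≤t)

weakenᵇ : ∀ {V} {Γ : List (Formula V)} {s A} {Δ} → Γ ⊆ Δ → Γ ⊢⟨ s ⟩ A → Δ ⊢⟨ s ⟩ A
weakenᵇ Γ⊆Δ (derivation π A∈ l) with substProof [] (inj₂ ∘ Γ⊆Δ) π
... | ms , ρ , sub , m = derivation ρ (sub A∈)
  (≤-trans (≤-reflexive (trans (length-++ ms) (+-identityʳ _))) (≤-trans m l))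

cutᵇ : ∀ {V} {Γ : List (Formula V)} {s t A B} → Γ ⊢⟨ s ⟩ A → A ∷ Γ ⊢⟨ t ⟩ B → Γ ⊢⟨ s + t ⟩ B
cutᵇ (derivation π A∈ l) (derivation ρ B∈ m)
  with substProof π (λ { (here refl) → inj₁ A∈ ; (there C∈) → inj₂ C∈ }) ρ
... | ms , τ , sub , n = derivation τ (sub B∈)
  (≤-trans (≤-reflexive (trans (length-++ ms) (+-comm (length ms) _))) (+-mono-≤ l (≤-trans n m)))

collect : ∀ {V} {Γ : List (Formula V)} {s} Δ → (∀ {A} → A ∈ Δ → Γ ⊢⟨ s ⟩ A) →
          ∃ λ ls → Proof Γ ls × Δ ⊆ ls × length ls ≤ length Δ * s
collect []      each = [] , [] , (λ ()) , z≤n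
collect (A ∷ Δ) each with each (here refl) | collect Δ (each ∘ there)
... | derivation {ls} π A∈ l | ms , ρ , sub , m = ls ++ ms , π ++ᵖ ρ ,
  (λ { (here refl) → ∈-++⁺ˡ A∈ ; (there B∈) → ∈-++⁺ʳ ls (sub B∈) }) ,
  ≤-trans (≤-reflexive (length-++ ls)) (+-mono-≤ l m)

cutAllᵇ : ∀ {V} {Γ : List (Formula V)} {s t B} (Δ : List (Formula V)) →
          (∀ {A} → A ∈ Δ → Γ ⊢⟨ s ⟩ A) → Δ ⊢⟨ t ⟩ B → Γ ⊢⟨ length Δ * s + t ⟩ B
cutAllᵇ Δ each (derivation ρ B∈ m) with collect Δ each
... | ls , π , sub , l with substProof π (inj₁ ∘ sub) ρ
...   | ms , τ , sub′ , n = derivation τ (sub′ B∈)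
  (≤-trans (≤-reflexive (trans (length-++ ms) (+-comm (length ms) _))) (+-mono-≤ l (≤-trans n m)))

-- Induction along a list, unwound into cuts: an entry costs its own derivation and one step of
-- uniform size, so the total is linear in the length.
foldᵇ : ∀ {V} {Γ : List (Formula V)} {P : Set} {s u} (Θ : P → Formula V) (Ψ : List P → Formula V) →
  Γ ⊢⟨ u ⟩ Ψ [] → (∀ p ps → Θ p ∷ Ψ ps ∷ Γ ⊢⟨ u ⟩ Ψ (p ∷ ps)) →
  ∀ ps → (∀ {p} → p ∈ ps → Γ ⊢⟨ s ⟩ Θ p) → Γ ⊢⟨ length ps * (s + u) + u ⟩ Ψ ps
foldᵇ Θ Ψ base step []       each = base
foldᵇ {s = s} {u} Θ Ψ base step (p ∷ ps) each = relax
  (≤-reflexive (trans (+-comm _ (s + u)) (sym (+-assoc (s + u) (length ps * (s + u)) u))))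
  (cutᵇ (foldᵇ Θ Ψ base step ps (each ∘ there))
        (cutᵇ (weakenᵇ there (each (here refl))) (step p ps)))

⋁ : ∀ {V P : Set} → (P → Formula V) → List P → Formula V
⋁ φ []       = ⊥
⋁ φ (p ∷ ps) = φ p ∨ ⋁ φ ps

-- A definable choice: `F` holds at the first entry satisfying `φ`. It lets formulas speak about one
-- witness of a disjunction although which one depends on the assignment.
atFirst : ∀ {V P : Set} → (P → Formula V) → List P → (P → Formula V) → Formula V
atFirst φ []       F = ⊥
atFirst φ (p ∷ ps) F = (φ p ∧ F p) ∨ (∼ φ p ∧ atFirst φ ps F)

module Calculus (B : ℕ) (5≤B : 5 ≤ B) {V : Set} where

  -- Derivability in at most B ^ e lines: B bounds the lengths of all lists
  -- involved, so that every rule raises e by a constant only.  Hypotheses and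
  -- axioms are available for all e, which lets unification balance the
  -- exponents of the premises of a rule.
  infix 3 _⊢[_]_

  record _⊢[_]_ (Γ : List (Formula V)) (e : ℕ) (A : Formula V) : Set where
    constructor ⟦_⟧
    field unwrap : Γ ⊢⟨ B ^ e ⟩ A

  open _⊢[_]_ public

  1≤B^ : ∀ e → 1 ≤ B ^ e
  1≤B^ zero    = ≤-refl
  1≤B^ (suc e) = *-mono-≤ (≤-trans (s≤s z≤n) 5≤B) (1≤B^ e)

  5*≤ : ∀ e → 5 * B ^ e ≤ B ^ suc e
  5*≤ e = *-monoˡ-≤ (B ^ e) 5≤B

  B^≤ : ∀ e → B ^ e ≤ B ^ suc e
  B^≤ e = ≤-trans (m≤m+n _ (4 * B ^ e)) (5*≤ e)

  lift : ∀ {Γ e A} → Γ ⊢[ e ] A → Γ ⊢[ suc e ] A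
  lift {e = e} ⟦ π ⟧ = ⟦ relax (B^≤ e) π ⟧

  up : ∀ d {Γ e A} → Γ ⊢[ e ] A → Γ ⊢[ d + e ] A
  up zero    π = π
  up (suc d) π = lift (up d π)

  weaken : ∀ {Γ Δ e A} → Γ ⊆ Δ → Γ ⊢[ e ] A → Δ ⊢[ e ] A
  weaken Γ⊆Δ ⟦ π ⟧ = ⟦ weakenᵇ Γ⊆Δ π ⟧

  assume : ∀ {Γ} {e A} → A ∈ Γ → Γ ⊢[ e ] A
  assume {e = e} A∈ = ⟦ relax (1≤B^ e) (hypᵇ A∈) ⟧

  ax : ∀ {Γ} {e A} → Axiom A → Γ ⊢[ e ] A
  ax {e = e} a = ⟦ relax (1≤B^ e) (axiomᵇ a) ⟧

  infixl 5 _·_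
  _·_ : ∀ {Γ} {e A C} → Γ ⊢[ e ] A ⇒ C → Γ ⊢[ e ] A → Γ ⊢[ suc e ] C
  _·_ {e = e} ⟦ π ⟧ ⟦ ρ ⟧ = ⟦ relax (≤-trans (+-monoˡ-≤ (B ^ e + B ^ e) (1≤B^ e))
    (≤-trans (+-monoʳ-≤ (B ^ e) (+-monoʳ-≤ (B ^ e) (m≤m+n _ _))) (5*≤ e))) (mpᵇ π ρ) ⟧

  ⇒I : ∀ {Γ e A C} → A ∷ Γ ⊢[ e ] C → Γ ⊢[ suc e ] A ⇒ C
  ⇒I {e = e} ⟦ π ⟧ = ⟦ relax (5*≤ e) (⇒Iᵇ π) ⟧

  fold : ∀ {Γ} {P : Set} {e} (Θ : P → Formula V) (Ψ : List P → Formula V) →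
    Γ ⊢[ e ] Ψ [] → (∀ p ps → Θ p ∷ Ψ ps ∷ Γ ⊢[ e ] Ψ (p ∷ ps)) →
    ∀ ps → length ps ≤ B → (∀ {p} → p ∈ ps → Γ ⊢[ e ] Θ p) → Γ ⊢[ 2 + e ] Ψ ps
  fold {Γ} {e = e} Θ Ψ ⟦ base ⟧ step ps len each =
    ⟦ relax bound (foldᵇ Θ Ψ base (λ p ps → unwrap (step p ps)) ps (unwrap ∘ each)) ⟧
    where
    open ≤-Reasoning
    bound : length ps * (B ^ e + B ^ e) + B ^ e ≤ B ^ (2 + e)
    bound = begin
      length ps * (B ^ e + B ^ e) + B ^ e       ≤⟨ +-mono-≤ (*-monoˡ-≤ (B ^ e + B ^ e) len) (B^≤ e) ⟩
      B * (B ^ e + B ^ e) + B ^ suc e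
        ≡⟨ cong (_+ B ^ suc e) (*-distribˡ-+ B (B ^ e) (B ^ e)) ⟩
      B ^ suc e + B ^ suc e + B ^ suc e         ≡⟨ +-assoc (B ^ suc e) _ _ ⟩
      B ^ suc e + (B ^ suc e + B ^ suc e)
        ≤⟨ +-monoʳ-≤ (B ^ suc e) (+-monoʳ-≤ (B ^ suc e) (m≤m+n _ _)) ⟩
      5 * B ^ suc e                             ≤⟨ 5*≤ (suc e) ⟩
      B ^ (2 + e)                               ∎

  ⊥E : ∀ {Γ e C} → Γ ⊢[ e ] ⊥ → Γ ⊢[ 2 + e ] C
  ⊥E {C = C} π = ax (dne C) · (ax (K ⊥ (∼ C)) · π)

  ∧I : ∀ {Γ e A C} → Γ ⊢[ e ] A → Γ ⊢[ e ] C → Γ ⊢[ 2 + e ] A ∧ C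
  ∧I π ρ = ax (∧-i _ _) · π · lift ρ

  ∧E₁ : ∀ {Γ} {e A C} → Γ ⊢[ e ] A ∧ C → Γ ⊢[ suc e ] A
  ∧E₁ π = ax (∧-e₁ _ _) · π

  ∧E₂ : ∀ {Γ} {e A C} → Γ ⊢[ e ] A ∧ C → Γ ⊢[ suc e ] C
  ∧E₂ π = ax (∧-e₂ _ _) · π

  ∨I₁ : ∀ {Γ} {e A C} → Γ ⊢[ e ] A → Γ ⊢[ suc e ] A ∨ C
  ∨I₁ π = ax (∨-i₁ _ _) · π

  ∨I₂ : ∀ {Γ} {e A C} → Γ ⊢[ e ] C → Γ ⊢[ suc e ] A ∨ C
  ∨I₂ π = ax (∨-i₂ _ _) · π

  ∨E : ∀ {Γ e A C D} → Γ ⊢[ e ] A ∨ C → A ∷ Γ ⊢[ e ] D → C ∷ Γ ⊢[ e ] D → Γ ⊢[ 4 + e ] D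
  ∨E π ρ τ = ax (∨-e _ _ _) · ⇒I ρ · lift (⇒I τ) · up 3 π

  RAA : ∀ {Γ e A} → ∼ A ∷ Γ ⊢[ e ] ⊥ → Γ ⊢[ 2 + e ] A
  RAA π = ax (dne _) · ⇒I π

  h₀ : ∀ {Γ e A} → A ∷ Γ ⊢[ e ] A
  h₀ = assume (here refl)

  h₁ : ∀ {Γ e A C} → C ∷ A ∷ Γ ⊢[ e ] A
  h₁ = weaken there h₀

  h₂ : ∀ {Γ e A C D} → D ∷ C ∷ A ∷ Γ ⊢[ e ] A
  h₂ = weaken there h₁

  h₃ : ∀ {Γ e A C D E} → E ∷ D ∷ C ∷ A ∷ Γ ⊢[ e ] A
  h₃ = weaken there h₂

  h₄ : ∀ {Γ e A C D E F} → F ∷ E ∷ D ∷ C ∷ A ∷ Γ ⊢[ e ] A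
  h₄ = weaken there h₃

  h₅ : ∀ {Γ e A C D E F G} → G ∷ F ∷ E ∷ D ∷ C ∷ A ∷ Γ ⊢[ e ] A
  h₅ = weaken there h₄

  EM : ∀ {Γ e C} A → A ∷ Γ ⊢[ e ] C → ∼ A ∷ Γ ⊢[ e ] C → Γ ⊢[ 6 + e ] C
  EM A π ρ = RAA (h₀ · (weaken there (lift (⇒I ρ)) · ⇒I (h₁ · weaken under π)))
    where
    under : ∀ {Γ A C} → A ∷ Γ ⊆ A ∷ C ∷ Γ
    under (here refl) = here refl
    under (there D∈)  = there (there D∈)

  ⋁I : ∀ {Γ e P p} {ps : List P} φ → length ps ≤ B → p ∈ ps → Γ ⊢[ e ] φ p → Γ ⊢[ 2 + e ] ⋁ φ ps
  ⋁I {Γ} {e} {p = p} {ps} φ len p∈ ⟦ π ⟧ = ⟦ relax bound (inject p∈) ⟧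
    where
    open ≤-Reasoning
    inject : ∀ {ps} → p ∈ ps → Γ ⊢⟨ length ps * 2 + B ^ e ⟩ ⋁ φ ps
    inject {_ ∷ ps} (here refl) =
      relax (+-monoʳ-≤ 2 (m≤n+m _ (length ps * 2))) (mpᵇ (axiomᵇ (∨-i₁ (φ p) (⋁ φ ps))) π)
    inject {q ∷ ps} (there p∈) = mpᵇ (axiomᵇ (∨-i₂ (φ q) (⋁ φ ps))) (inject p∈)
    bound : length ps * 2 + B ^ e ≤ B ^ (2 + e)
    bound = begin
      length ps * 2 + B ^ e
        ≤⟨ +-mono-≤ (*-mono-≤ len (+-mono-≤ (1≤B^ e) (1≤B^ e))) (B^≤ e) ⟩
      B * (B ^ e + B ^ e) + B ^ suc e      ≡⟨ cong (_+ B ^ suc e) (*-distribˡ-+ B (B ^ e) (B ^ e)) ⟩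
      B ^ suc e + B ^ suc e + B ^ suc e    ≡⟨ +-assoc (B ^ suc e) _ _ ⟩
      B ^ suc e + (B ^ suc e + B ^ suc e)
        ≤⟨ +-monoʳ-≤ (B ^ suc e) (+-monoʳ-≤ (B ^ suc e) (m≤m+n _ _)) ⟩
      5 * B ^ suc e                        ≤⟨ 5*≤ (suc e) ⟩
      B ^ (2 + e)                          ∎

  ⋁E : ∀ {Γ e C P} φ (ps : List P) → length ps ≤ B → Γ ⊢[ e ] ⋁ φ ps →
       (∀ {p} → p ∈ ps → φ p ∷ Γ ⊢[ e ] C) → Γ ⊢[ 6 + e ] C
  ⋁E {C = C} φ ps len π each =
    fold (λ p → φ p ⇒ C) (λ ps → ⋁ φ ps ⇒ C)
      (⇒I (⊥E h₀)) (λ p ps → ax (∨-e _ _ _) · h₀ · h₁)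
      ps len (λ p∈ → up 2 (⇒I (each p∈)))
    · up 5 π

  -- The first entry satisfying `φ` is the same for both formulas, so `F` and `G` need to be
  -- contradictory only at a common entry.
  atFirst-clash : ∀ {Γ e P} φ F G (ps : List P) → length ps ≤ B →
    (∀ {p} → p ∈ ps → G p ∷ F p ∷ φ p ∷ Γ ⊢[ e ] ⊥) →
    Γ ⊢[ e ] atFirst φ ps F → Γ ⊢[ e ] atFirst φ ps G → Γ ⊢[ 18 + e ] ⊥
  atFirst-clash φ F G ps len each π ρ =
    fold (λ p → φ p ⇒ F p ⇒ G p ⇒ ⊥) (λ ps → atFirst φ ps F ⇒ atFirst φ ps G ⇒ ⊥)
      (⇒I (⇒I h₁))
      (λ p ps → ⇒I (⇒I (∨E h₁
        (∨E h₁ (h₄ · ∧E₁ h₁ · ∧E₂ h₁ · ∧E₂ h₀) (∧E₁ h₀ · ∧E₁ h₁))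
        (∨E h₁ (∧E₁ h₁ · ∧E₁ h₀) (h₅ · ∧E₂ h₁ · ∧E₂ h₀)))))
      ps len (λ p∈ → up 11 (⇒I (⇒I (⇒I (each p∈)))))
    · up 16 π · up 17 ρ

  -- Whichever entry comes first, some `h` serves it; the disjunction over `h` is thus moved outside
  -- the choice of the entry.
  atFirst-some : ∀ {Γ e P H} φ (F : H → P → Formula V) ps hs → length ps ≤ B → length hs ≤ B →
    (∀ {p} → p ∈ ps → φ p ∷ Γ ⊢[ e ] ⋁ (λ h → F h p) hs) →
    Γ ⊢[ e ] ⋁ φ ps → Γ ⊢[ 24 + e ] ⋁ (λ h → atFirst φ ps (F h)) hs
  atFirst-some φ F ps hs len len′ each π =
    fold (λ p → φ p ⇒ ⋁ (λ h → F h p) hs) (λ ps → ⋁ φ ps ⇒ ⋁ (λ h → atFirst φ ps (F h)) hs)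
      (⇒I (⊥E h₀))
      (λ p ps → ⇒I (EM (φ p)
        (⋁E _ hs len′ (h₂ · h₀) λ h∈ → ⋁I _ len′ h∈ (∨I₁ (∧I h₁ h₀)))
        (⋁E _ hs len′ (h₃ · ∨E h₁ (⊥E (h₁ · h₀)) h₀) λ h∈ → ⋁I _ len′ h∈ (∨I₂ (∧I h₁ h₀)))))
      ps len (λ p∈ → up 20 (⇒I (each p∈)))
    · up 23 π

-- The pigeonhole principle

-- Serves two purposes: with all pairs as edges it is the pigeonhole principle, a colouring of a
-- complete graph; with the disjoint pairs it is the colouring of the stable Kneser graph.
colouring : ∀ {V P H : Set} → List P → List (P × P) → List H → (P → H → Formula V) → List (Formula V)
colouring vs es hs F =
  map (λ v → ⋁ (F v) hs) vs ++
  map (λ ((v , w) , h) → F v h ⇒ ∼ F w h) (cartesianProduct es hs)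

module _ {V P H : Set} {vs : List P} {es : List (P × P)} {hs : List H} (F : P → H → Formula V) where

  ∈-some : ∀ {v} → v ∈ vs → ⋁ (F v) hs ∈ colouring vs es hs F
  ∈-some v∈ = ∈-++⁺ˡ (∈-map⁺ (λ v → ⋁ (F v) hs) v∈)

  ∈-proper : ∀ {v w h} → (v , w) ∈ es → h ∈ hs → (F v h ⇒ ∼ F w h) ∈ colouring vs es hs F
  ∈-proper e∈ h∈ = ∈-++⁺ʳ (map (λ v → ⋁ (F v) hs) vs) (∈-map⁺ _ (∈-cartesianProduct⁺ e∈ h∈))

  colouring-each : ∀ {Q : Formula V → Set} →
    (∀ {v} → v ∈ vs → Q (⋁ (F v) hs)) →
    (∀ {v w h} → (v , w) ∈ es → h ∈ hs → Q (F v h ⇒ ∼ F w h)) →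
    ∀ {A} → A ∈ colouring vs es hs F → Q A
  colouring-each some proper A∈ with ∈-++⁻ (map (λ v → ⋁ (F v) hs) vs) A∈
  ... | inj₁ A∈some with ∈-map⁻ _ A∈some
  ...   | _ , v∈ , refl = some v∈
  colouring-each some proper A∈ | inj₂ A∈proper with ∈-map⁻ _ A∈proper
  ...   | _ , e∈ , refl with ∈-cartesianProduct⁻ es hs e∈
  ...     | vw∈ , h∈ = proper vw∈ h∈

length-cartesianProduct : ∀ {A B : Set} (xs : List A) (ys : List B) →
  length (cartesianProduct xs ys) ≡ length xs * length ys
length-cartesianProduct []       ys = refl
length-cartesianProduct (x ∷ xs) ys = trans (length-++ (map (x ,_) ys))
  (cong₂ _+_ (length-map (x ,_) ys) (length-cartesianProduct xs ys))

length-pairs : ∀ {A : Set} (xs : List A) → length (pairs xs) ≤ length xs * length xs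
length-pairs []       = z≤n
length-pairs (x ∷ xs) = begin
  length (map (x ,_) xs ++ pairs xs)         ≡⟨ length-++ (map (x ,_) xs) ⟩
  length (map (x ,_) xs) + length (pairs xs)
    ≤⟨ +-mono-≤ (≤-trans (≤-reflexive (length-map (x ,_) xs)) (n≤1+n _))
                                                         (≤-trans (length-pairs xs)
                                                           (*-monoʳ-≤ (length xs) (n≤1+n _))) ⟩
  suc (length xs) * suc (length xs)          ∎
  where open ≤-Reasoning

∈-pairs⁻ : ∀ {A : Set} {xs : List A} {x y} → (x , y) ∈ pairs xs → x ∈ xs × y ∈ xs
∈-pairs⁻ {xs = z ∷ xs} xy∈ with ∈-++⁻ (map (z ,_) xs) xy∈
... | inj₂ xy∈′ with ∈-pairs⁻ xy∈′
...   | x∈ , y∈ = there x∈ , there y∈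
∈-pairs⁻ {xs = z ∷ xs} xy∈ | inj₁ xy∈′ with ∈-map⁻ (z ,_) xy∈′
...   | _ , y∈ , refl = here refl , there y∈

module Pigeonhole (B : ℕ) (5≤B : 5 ≤ B) {V : Set} where
  open Calculus B 5≤B {V}

  length-colouring : ∀ {P H : Set} (vs : List P) (es : List (P × P)) (hs : List H)
    {F : P → H → Formula V} →
    length vs ≤ B → length es ≤ B * B → length hs ≤ B → length (colouring vs es hs F) ≤ B ^ 4
  length-colouring vs es hs {F} vs≤ es≤ hs≤ = begin
    length (colouring vs es hs F)
      ≡⟨ trans (length-++ (map (λ v → ⋁ (F v) hs) vs))
               (cong₂ _+_ (length-map _ vs)
                 (trans (length-map _ (cartesianProduct es hs)) (length-cartesianProduct es hs))) ⟩
    length vs + length es * length hs    ≤⟨ +-mono-≤ vs≤ (*-mono-≤ es≤ hs≤) ⟩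
    B + B * B * B
      ≡⟨ cong₂ _+_ (sym (*-identityʳ B))
      (trans (*-assoc B B B) (cong (λ b → B * (B * b)) (sym (*-identityʳ B)))) ⟩
    B ^ 1 + B ^ 3                        ≤⟨ +-monoˡ-≤ (B ^ 3) (≤-trans (B^≤ 1) (B^≤ 2)) ⟩
    B ^ 3 + B ^ 3                        ≤⟨ +-monoʳ-≤ (B ^ 3) (m≤m+n _ _) ⟩
    5 * B ^ 3                            ≤⟨ 5*≤ 3 ⟩
    B ^ 4                                ∎
    where open ≤-Reasoning

  cutColouring : ∀ {Γ e s A} {P H : Set} (vs : List P) (es : List (P × P)) (hs : List H)
    (F : P → H → Formula V) →
    length vs ≤ B → length es ≤ B * B → length hs ≤ B →
    (∀ {v} → v ∈ vs → Γ ⊢[ e ] ⋁ (F v) hs) →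
    (∀ {v w h} → (v , w) ∈ es → h ∈ hs → Γ ⊢[ e ] F v h ⇒ ∼ F w h) →
    colouring vs es hs F ⊢⟨ s ⟩ A → Γ ⊢⟨ B ^ (4 + e) + s ⟩ A
  cutColouring {e = e} {s} vs es hs F vs≤ es≤ hs≤ some proper π = relax
    (+-monoˡ-≤ s (≤-trans (*-monoˡ-≤ (B ^ e) (length-colouring vs es hs vs≤ es≤ hs≤))
                          (≤-reflexive (sym (^-distribˡ-+-* B 4 e)))))
    (cutAllᵇ (colouring vs es hs F)
             (colouring-each F (λ v∈ → unwrap (some v∈)) (λ e∈ h∈ → unwrap (proper e∈ h∈))) π)

  -- Cook's reduction: the pigeon p₀ and the hole h₀ are removed, and the
  -- pigeon sitting in h₀ is sent to the hole of p₀.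
  php : ∀ {P H : Set} (ps : List P) (hs : List H) (F : P → H → Formula V) → length hs < length ps →
    length ps ≤ B →
    colouring ps (pairs ps) hs F ⊢⟨ length hs * B ^ 21 + B ^ 21 ⟩ ⊥
  php (p ∷ ps) [] F _ _ =
    unwrap {e = 21} (assume (∈-some {vs = p ∷ ps} {es = pairs (p ∷ ps)} F (here refl)))
  -- One level costs B ^ (4 + 17) lines, added to the cost of the smaller instance. `F′` contains
  -- three copies of `F`, so formulas grow exponentially while the lines do not.
  php {P} {H} (p₀ ∷ ps) (h₀′ ∷ hs) F hs<ps ps≤B = relax (≤-reflexive (sym (+-assoc (B ^ 21) _ _)))
    (cutColouring ps (pairs ps) hs F′ (<⇒≤ ps≤B)
      (≤-trans (length-pairs ps) (*-mono-≤ (<⇒≤ ps≤B) (<⇒≤ ps≤B))) hs≤B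
      some proper (php ps hs F′ (s≤s⁻¹ hs<ps) (<⇒≤ ps≤B)))
    where
    Δ = colouring (p₀ ∷ ps) (pairs (p₀ ∷ ps)) (h₀′ ∷ hs) F
    F′ : P → H → Formula V
    F′ p h = F p h ∨ F p h₀′ ∧ F p₀ h
    hs≤B : length hs ≤ B
    hs≤B = ≤-trans (<⇒≤ (<⇒≤ hs<ps)) ps≤B
    hs⁺≤B : length (h₀′ ∷ hs) ≤ B
    hs⁺≤B = ≤-trans (<⇒≤ hs<ps) ps≤B
    clash₀ : ∀ {e p h} → p ∈ ps → h ∈ h₀′ ∷ hs → Δ ⊢[ e ] F p₀ h ⇒ ∼ F p h
    clash₀ p∈ h∈ = assume
      (∈-proper {vs = p₀ ∷ ps} {es = pairs (p₀ ∷ ps)} F (∈-++⁺ˡ (∈-map⁺ (p₀ ,_) p∈)) h∈)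
    clash : ∀ {e p q h} → (p , q) ∈ pairs ps → h ∈ h₀′ ∷ hs → Δ ⊢[ e ] F p h ⇒ ∼ F q h
    clash pq∈ h∈ = assume
      (∈-proper {vs = p₀ ∷ ps} {es = pairs (p₀ ∷ ps)} F (∈-++⁺ʳ (map (p₀ ,_) ps) pq∈) h∈)
    some : ∀ {p} → p ∈ ps → Δ ⊢[ 17 ] ⋁ (F′ p) hs
    some {p} p∈ = ⋁E (F p) (h₀′ ∷ hs) hs⁺≤B
      (assume (∈-some {vs = p₀ ∷ ps} {es = pairs (p₀ ∷ ps)} F (there p∈))) λ where
      (here refl) → ⋁E (F p₀) (h₀′ ∷ hs) hs⁺≤B
        (weaken there (assume (∈-some {vs = p₀ ∷ ps} {es = pairs (p₀ ∷ ps)} F (here refl)))) λ where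
        (here refl) → ⊥E (weaken (there ∘ there) (clash₀ p∈ (here refl)) · h₀ · h₁)
        (there h∈)  → ⋁I (F′ p) hs≤B h∈ (∨I₂ (∧I h₁ h₀))
      (there h∈)  → ⋁I (F′ p) hs≤B h∈ (∨I₁ h₀)
    proper : ∀ {p q h} → (p , q) ∈ pairs ps → h ∈ hs → Δ ⊢[ 17 ] F′ p h ⇒ ∼ F′ q h
    proper pq∈ h∈ = ⇒I (⇒I (∨E h₁
      (∨E h₁ (deep (clash pq∈ (there h∈)) · h₁ · h₀)
             (deep (clash₀ (proj₁ (∈-pairs⁻ pq∈)) (there h∈)) · ∧E₂ h₀ · h₁))
      (∨E h₁ (deep (clash₀ (proj₂ (∈-pairs⁻ pq∈)) (there h∈)) · ∧E₂ h₁ · h₀)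
             (deep (clash pq∈ (here refl)) · ∧E₁ h₁ · ∧E₁ h₀))))
      where
      deep : ∀ {e A C₀ C₁ C₂ C₃} → Δ ⊢[ e ] A → C₀ ∷ C₁ ∷ C₂ ∷ C₃ ∷ Δ ⊢[ e ] A
      deep = weaken (there ∘ there ∘ there ∘ there)

-- Arithmetic progressions as vertices

-- {w, w + (1 + g), w + 2 (1 + g), …}, with k elements if n is large enough.
progression : ℕ → ℕ → ℕ → ∀ n → Subset n
progression g w       zero    n       = ∅
progression g w       (suc k) zero    = Vec.[]
progression g zero    (suc k) (suc n) = inside Vec.∷ progression g g k n
progression g (suc w) (suc k) (suc n) = outside Vec.∷ progression g w (suc k) n

∣progression∣ : ∀ g w k n → w + k * suc g ≤ n → ∣ progression g w k n ∣ ≡ k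
∣progression∣ g w       zero    n       _  = ∣⊥∣≡0 n
∣progression∣ g zero    (suc k) (suc n) le = cong suc (∣progression∣ g g k n (s≤s⁻¹ le))
∣progression∣ g (suc w) (suc k) (suc n) le = ∣progression∣ g w (suc k) n (s≤s⁻¹ le)
∣progression∣ g zero    (suc k) zero    ()
∣progression∣ g (suc w) (suc k) zero    ()

∈-progression : ∀ g w k n {i} → i ∈ₛ progression g w k n → ∃ λ j → j < k × toℕ i ≡ w + j * suc g
∈-progression g w       zero    n       i∈ = contradiction i∈ ∉⊥
∈-progression g zero    (suc k) (suc n) Vec.here = 0 , s≤s z≤n , refl
∈-progression g zero    (suc k) (suc n) (Vec.there i∈) with ∈-progression g g k n i∈
... | j , j<k , eq = suc j , s≤s j<k , cong suc eq
∈-progression g (suc w) (suc k) (suc n) (Vec.there i∈) with ∈-progression g w (suc k) n i∈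
... | j , j<k , eq = j , j<k , cong suc eq

-- The bound leaves room for a full step beyond the last chosen element. With a step of at least 2
-- this keeps the end of the ground set free, and no pair wraps around.
spread-progression : ∀ g w k n → 1 ≤ g → w + k * suc g ≤ n → Spread false false (progression g w k n)
spread-progression g       w       zero    n       _   _  = Spread-∅ false n
spread-progression (suc g) zero    (suc k) (suc n) 1≤g le = blocked-progression k n (s≤s⁻¹ le)
  where
  blocked-progression : ∀ k n → suc g + k * suc (suc g) ≤ n →
    Spread false true (progression (suc g) (suc g) k n)
  blocked-progression zero    (suc n) le = Spread-∅ false n
  blocked-progression (suc k) (suc n) le = spread-progression (suc g) g (suc k) n 1≤g (s≤s⁻¹ le)
spread-progression g       (suc w) (suc k) (suc n) 1≤g le =
  spread-progression g w (suc k) n 1≤g (s≤s⁻¹ le)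
spread-progression g       zero    (suc k) zero    _ ()
spread-progression g       (suc w) (suc k) zero    _ ()

-- For a, b < r these sets pairwise share at most one element: an element
-- determines j and b + j a, since b + j a < 1 + r k.
line : ∀ n → ℕ → ℕ → ℕ × ℕ → Subset n
line n r k (a , b) = progression (r * k + a) b k n

line-vertex : ∀ {n r k a b} → 1 ≤ k → r * suc (k + k * k) ≤ n → a < r → b < r →
  IsVertex k (line n r k (a , b))
line-vertex {n} {r} {k} {a} {b} 1≤k r≤ a<r b<r =
  ∣progression∣ (r * k + a) b k n fits ,
  spread⇒stable false _ (spread-progression (r * k + a) b k n
    (≤-trans (*-mono-≤ (≤-trans (s≤s z≤n) a<r) 1≤k) (m≤m+n (r * k) a)) fits)
  where
  open ≤-Reasoning
  fits : b + k * suc (r * k + a) ≤ n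
  fits = begin
    b + k * suc (r * k + a)    ≡⟨ cong (λ e → b + k * e) (+-suc (r * k) a) ⟨
    b + k * (r * k + suc a)    ≤⟨ +-mono-≤ (<⇒≤ b<r) (*-monoʳ-≤ k (+-monoʳ-≤ (r * k) a<r)) ⟩
    r + k * (r * k + r)
      ≡⟨ solve 2 (λ r k → r :+ k :* (r :* k :+ r) := r :* (con 1 :+ (k :+ k :* k))) refl r k ⟩
    r * suc (k + k * k)        ≤⟨ r≤ ⟩
    n                          ∎
    where open +-*-Solver

∈-line : ∀ {n r k a b i} → a < r → b < r → i ∈ₛ line n r k (a , b) →
         ∃ λ j → b + j * a < suc (r * k) × toℕ i ≡ (b + j * a) + j * suc (r * k)
∈-line {n} {r} {k} {a} {b} a<r b<r i∈ with ∈-progression (r * k + a) b k n i∈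
... | j , j<k , eq = j , s≤s bound , trans eq
    (solve 4 (λ a b j d → b :+ j :* (con 1 :+ (d :+ a)) := (b :+ j :* a) :+ j :* (con 1 :+ d)) refl
      a b j (r * k))
  where
  open +-*-Solver
  open ≤-Reasoning
  bound : b + j * a ≤ r * k
  bound = begin
    b + j * a    ≤⟨ +-mono-≤ (<⇒≤ b<r) (*-monoʳ-≤ j (<⇒≤ a<r)) ⟩
    suc j * r    ≤⟨ *-monoˡ-≤ r j<k ⟩
    k * r        ≡⟨ *-comm k r ⟩
    r * k        ∎

remainder-unique : ∀ {d x x′ j j′} → x < suc d → x′ < suc d → x + j * suc d ≡ x′ + j′ * suc d →
  x ≡ x′ × j ≡ j′
remainder-unique {d} {x} {x′} {j} {j′} x<d x′<d eq with x≡x′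
  where
  x≡x′ : x ≡ x′
  x≡x′ = begin
    x                          ≡⟨ m<n⇒m%n≡m x<d ⟨
    x % suc d                  ≡⟨ [m+kn]%n≡m%n x j (suc d) ⟨
    (x + j * suc d) % suc d    ≡⟨ cong (_% suc d) eq ⟩
    (x′ + j′ * suc d) % suc d  ≡⟨ [m+kn]%n≡m%n x′ j′ (suc d) ⟩
    x′ % suc d                 ≡⟨ m<n⇒m%n≡m x′<d ⟩
    x′                         ∎
    where open ≡-Reasoning
... | refl = refl , *-cancelʳ-≡ j j′ (suc d) (+-cancelˡ-≡ x _ _ eq)

slope-≮ : ∀ {a a′ b b′ j j′} → j ≢ j′ → b + j * a ≡ b′ + j * a′ → b + j′ * a ≡ b′ + j′ * a′ → ¬ a < a′
slope-≮ {a} {a′} {b} {b′} {j} {j′} j≢j′ eq eq′ a<a′ with m≤n⇒∃[o]m+o≡n a<a′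
... | d , refl = j≢j′ (*-cancelʳ-≡ j j′ (suc d)
    (+-cancelˡ-≡ b′ _ _ (trans (sym (difference j eq)) (difference j′ eq′))))
  where
  open +-*-Solver
  difference : ∀ j → b + j * a ≡ b′ + j * (suc a + d) → b ≡ b′ + j * suc d
  difference j eq = +-cancelʳ-≡ (j * a) _ _ (trans eq
    (solve 4 (λ a b j d → b :+ j :* (con 1 :+ a :+ d) := (b :+ j :* (con 1 :+ d)) :+ j :* a) refl
      a b′ j d))

-- Quotient j and remainder b + j a act as plane coordinates, so each set lies on a line of slope a
-- and intercept b. Two distinct common elements have different j, and two such points determine the
-- line.
line-unique : ∀ {n r k a b a′ b′} {x y : Fin n} → a < r → b < r → a′ < r → b′ < r → x ≢ y →
  x ∈ₛ line n r k (a , b) → y ∈ₛ line n r k (a , b) →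
  x ∈ₛ line n r k (a′ , b′) → y ∈ₛ line n r k (a′ , b′) → (a , b) ≡ (a′ , b′)
line-unique {n} {r} {k} {a} {b} {a′} {b′} {x} {y} a<r b<r a′<r b′<r x≢y x∈ y∈ x∈′ y∈′
  with ∈-line {r = r} {k} a<r b<r x∈ | ∈-line {r = r} {k} a<r b<r y∈
     | ∈-line {r = r} {k} a′<r b′<r x∈′ | ∈-line {r = r} {k} a′<r b′<r y∈′
... | j , lt , x≡ | i , lu , y≡ | j′ , lt′ , x≡′ | i′ , lu′ , y≡′
  with remainder-unique {j = j} {j′} lt lt′ (trans (sym x≡) x≡′)
     | remainder-unique {j = i} {i′} lu lu′ (trans (sym y≡) y≡′)
... | eq , refl | eq′ , refl with <-cmp a a′
...   | tri< a<a′ _ _ = contradiction a<a′ (slope-≮ j≢i eq eq′)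
  where
  j≢i : j ≢ i
  j≢i refl = x≢y (toℕ-injective (trans x≡ (sym y≡)))
...   | tri> _ _ a′<a = contradiction a′<a (slope-≮ j≢i (sym eq) (sym eq′))
  where
  j≢i : j ≢ i
  j≢i refl = x≢y (toℕ-injective (trans x≡ (sym y≡)))
...   | tri≈ _ refl _ = cong (a ,_) (+-cancelʳ-≡ (j * a) _ _ eq)

-- Inserting an element into the ground set

punchIn-first : ∀ {n} (x : Fin (suc n)) i → toℕ (punchIn x i) ≡ 0 → toℕ i ≡ 0
punchIn-first (suc x) zero eq = refl

punchIn-step : ∀ {n} (x : Fin (suc n)) i j → toℕ (punchIn x j) ≡ suc (toℕ (punchIn x i)) →
  toℕ j ≡ suc (toℕ i)
punchIn-step zero    i       j       eq = suc-injective eq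
punchIn-step (suc x) zero    (suc j) eq = cong suc (punchIn-first x j (suc-injective eq))
punchIn-step (suc x) (suc i) (suc j) eq = cong suc (punchIn-step x i j (suc-injective eq))

punchIn-≤ : ∀ {n} (x : Fin (suc n)) i → toℕ (punchIn x i) ≤ suc (toℕ i)
punchIn-≤ zero    i       = ≤-refl
punchIn-≤ (suc x) zero    = z≤n
punchIn-≤ (suc x) (suc i) = s≤s (punchIn-≤ x i)

extend : ∀ {n} → Fin (suc n) → Subset n → Subset (suc n)
extend x A = insertAt A x outside

∉-extend : ∀ {n} (x : Fin (suc n)) A → x ∉ₛ extend x A
∉-extend x A x∈ with trans (sym ([]=⇒lookup x∈)) (insertAt-lookup A x outside)
... | ()

∈-extend⁻ : ∀ {n} (x : Fin (suc n)) A {i} → i ∈ₛ extend x A → ∃ λ j → i ≡ punchIn x j × j ∈ₛ A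
∈-extend⁻ x A {i} i∈ with x ≟ᶠ i
... | yes refl = contradiction i∈ (∉-extend x A)
... | no  x≢i  = punchOut x≢i , sym (punchIn-punchOut x≢i) , lookup⇒[]= _ A (begin
  lookup A (punchOut x≢i)                          ≡⟨ insertAt-punchIn A x outside (punchOut x≢i) ⟨
  lookup (extend x A) (punchIn x (punchOut x≢i))
    ≡⟨ cong (lookup (extend x A)) (punchIn-punchOut x≢i) ⟩
  lookup (extend x A) i                            ≡⟨ []=⇒lookup i∈ ⟩
  inside                                           ∎)
  where open ≡-Reasoning

∣extend∣ : ∀ {n} (x : Fin (suc n)) A → ∣ extend x A ∣ ≡ ∣ A ∣
∣extend∣ zero    A                   = refl
∣extend∣ (suc x) (inside  Vec.∷ A) = cong suc (∣extend∣ x A)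
∣extend∣ (suc x) (outside Vec.∷ A) = ∣extend∣ x A

-- A new point can only separate neighbours on the cycle: elements consecutive after the insertion
-- were consecutive before.
extend-stable : ∀ {n} (x : Fin (suc n)) {A} → Stable A → Stable (extend x A)
extend-stable {n} x {A} stable i j i∈ j∈ consec with ∈-extend⁻ x A i∈ | ∈-extend⁻ x A j∈
... | i′ , refl , i′∈ | j′ , refl , j′∈ = stable i′ j′ i′∈ j′∈ (shrink consec)
  where
  shrink : Consecutive (punchIn x i′) (punchIn x j′) → Consecutive i′ j′
  shrink (inj₁ eq)         = inj₁ (punchIn-step x i′ j′ eq)
  shrink (inj₂ (eq , eq′)) =
    inj₂ (≤-antisym (toℕ<n i′) (subst (_≤ suc (toℕ i′)) (suc-injective eq) (punchIn-≤ x i′)) ,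
                                   punchIn-first x j′ eq′)

extend-vertex : ∀ {n k} (x : Fin (suc n)) {A} → IsVertex k A → IsVertex k (extend x A)
extend-vertex x {A} (size , stable) = trans (∣extend∣ x A) size , extend-stable x stable

extend-disjoint : ∀ {n} (x : Fin (suc n)) {A B} → Empty (A ∩ B) → Empty (extend x A ∩ extend x B)
extend-disjoint x {A} {B} empty (i , i∈) with x∈p∩q⁻ (extend x A) (extend x B) i∈
... | i∈A , i∈B with ∈-extend⁻ x A i∈A | ∈-extend⁻ x B i∈B
...   | j , refl , j∈A | j′ , eq , j′∈B with punchIn-injective x j j′ eq
...     | refl = empty (j , x∈p∩q⁺ (j∈A , j′∈B))

nth : ∀ {n} → Subset n → ℕ → Maybe (Fin n)
nth Vec.[]              s       = nothing
nth (outside Vec.∷ A) s       = Maybe.map suc (nth A s)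
nth (inside  Vec.∷ A) zero    = just zero
nth (inside  Vec.∷ A) (suc s) = Maybe.map suc (nth A s)

nth-complete : ∀ {n} (A : Subset n) {x} → x ∈ₛ A → ∃ λ s → s < ∣ A ∣ × nth A s ≡ just x
nth-complete (inside Vec.∷ A)  Vec.here = 0 , s≤s z≤n , refl
nth-complete (inside Vec.∷ A)  (Vec.there x∈) with nth-complete A x∈
... | s , s< , eq = suc s , s≤s s< , cong (Maybe.map suc) eq
nth-complete (outside Vec.∷ A) (Vec.there x∈) with nth-complete A x∈
... | s , s< , eq = s , s< , cong (Maybe.map suc) eq

nth-sound : ∀ {n} (A : Subset n) s {x} → nth A s ≡ just x → x ∈ₛ A
nth-sound (inside  Vec.∷ A) zero    refl = Vec.here
nth-sound (inside  Vec.∷ A) (suc s) eq with nth A s in eq′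
nth-sound (inside  Vec.∷ A) (suc s) refl | just x = Vec.there (nth-sound A s eq′)
nth-sound (outside Vec.∷ A) s       eq with nth A s in eq′
nth-sound (outside Vec.∷ A) s       refl | just x = Vec.there (nth-sound A s eq′)

length-filter-mono : ∀ {A B : Set} {P : A → Set} {Q : B → Set} (P? : ∀ a → Dec (P a))
  (Q? : ∀ b → Dec (Q b)) (f : A → B) →
  (∀ a → P a → Q (f a)) → ∀ xs → length (filter P? xs) ≤ length (filter Q? (map f xs))
length-filter-mono P? Q? f P⇒Q []       = z≤n
length-filter-mono P? Q? f P⇒Q (x ∷ xs) with P? x | Q? (f x)
... | yes _ | yes _ = s≤s (length-filter-mono P? Q? f P⇒Q xs)
... | yes p | no ¬q = contradiction (P⇒Q x p) ¬q
... | no  _ | yes _ = ≤-trans (length-filter-mono P? Q? f P⇒Q xs) (n≤1+n _)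
... | no  _ | no  _ = length-filter-mono P? Q? f P⇒Q xs

length-stableSubsets-mono : ∀ n k → length (stableSubsets n k) ≤ length (stableSubsets (suc n) k)
length-stableSubsets-mono n k = begin
  length (filter (isVertex? k) (subsets n))
    ≤⟨ length-filter-mono (isVertex? k) (isVertex? k) (outside Vec.∷_) (λ A → extend-vertex zero)
      (subsets n) ⟩
  length (filter (isVertex? k) ys)                                     ≤⟨ m≤n+m _ _ ⟩
  length (filter (isVertex? k) xs) + length (filter (isVertex? k) ys)
    ≡⟨ length-++ (filter (isVertex? k) xs) ⟨
  length (filter (isVertex? k) xs ++ filter (isVertex? k) ys)
    ≡⟨ cong length (filter-++ (isVertex? k) xs ys) ⟨
  length (filter (isVertex? k) (xs ++ ys))                             ∎
  where
  open ≤-Reasoning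
  xs = map (inside Vec.∷_) (subsets n)
  ys = map (outside Vec.∷_) (subsets n)

-- Star-shaped colour classes

pairs-AllPairs : ∀ {A : Set} {R : A → A → Set} {xs x y} → AllPairs R xs → (x , y) ∈ pairs xs → R x y
pairs-AllPairs {xs = z ∷ xs} (Rz ∷ Rxs) xy∈ with ∈-++⁻ (map (z ,_) xs) xy∈
... | inj₂ xy∈′ = pairs-AllPairs Rxs xy∈′
... | inj₁ xy∈′ with ∈-map⁻ (z ,_) xy∈′
...   | _ , y∈ , refl = All.lookup Rz y∈

length-allFin : ∀ n → length (allFin n) ≡ n
length-allFin n = length-tabulate id

disjointPairs : ∀ n k → List (Subset n × Subset n)
disjointPairs n k = filter (λ (A , C) → ¬? (nonempty? (A ∩ C)))
  (cartesianProduct (stableSubsets n k) (stableSubsets n k))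

-- F A i is read as: the vertex A has the colour i.
theory : ∀ {V} n k c → (Subset n → Fin c → Formula V) → List (Formula V)
theory n k c F = colouring (stableSubsets n k) (disjointPairs n k) (allFin c) F

module Reduction (B : ℕ) (5≤B : 5 ≤ B) {V : Set} (k : ℕ) (1≤k : 1 ≤ k) where
  open Calculus B 5≤B {V}
  open Pigeonhole B 5≤B {V}

  avoiding : ∀ {n} → Fin n → List (Subset n)
  avoiding x = filter (λ A → ¬? (x ∈? A)) (stableSubsets _ k)

  module _ {n c : ℕ} (F : Subset n → Fin c → Formula V)
           (N≤B : length (stableSubsets n k) ≤ B) (c≤B : c ≤ B) where

    private
      L = stableSubsets n k
      Δ = theory n k c F

    some-colour : ∀ {A e} → A ∈ L → Δ ⊢[ e ] ⋁ (F A) (allFin c)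
    some-colour A∈ = assume (∈-some {vs = L} {disjointPairs n k} F A∈)

    proper-colour : ∀ {A C i e} → A ∈ L → C ∈ L → Empty (A ∩ C) → Δ ⊢[ e ] F A i ⇒ ∼ F C i
    proper-colour {i = i} A∈ C∈ empty = assume (∈-proper {vs = L} {disjointPairs n k} F
      (∈-filter⁺ _ (∈-cartesianProduct⁺ A∈ C∈) empty) (∈-allFin i))

    colours≤B : length (allFin c) ≤ B
    colours≤B = subst (_≤ B) (sym (length-allFin c)) c≤B

    avoiding≤B : ∀ (x : Fin n) → length (avoiding x) ≤ B
    avoiding≤B x = ≤-trans (length-filter _ L) N≤B

    -- Sets of one colour must intersect. A disjoint pair is refuted by its properness axiom; for an
    -- intersecting pair the common element and its position in `A` are found outside the calculus.
    meet : ∀ {A C i e G Γ} → Δ ⊆ Γ → A ∈ L → C ∈ L → F C i ∈ Γ →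
      (∀ {s x} → s < k → nth A s ≡ just x → x ∈ₛ A → x ∈ₛ C → F A i ∷ Γ ⊢[ 4 + e ] G) →
        F A i ∷ Γ ⊢[ 4 + e ] G
    meet {A} {C} {i} Δ⊆Γ A∈ C∈ FC∈ common with nonempty? (A ∩ C)
    ... | no empty = ⊥E (weaken (there ∘ Δ⊆Γ) (proper-colour {i = i} A∈ C∈ empty) · h₀
                          · assume (there FC∈))
    ... | yes (x , x∈) with x∈p∩q⁻ A C x∈
    ...   | x∈A , x∈C with nth-complete A x∈A
    ...     | s , s< , eq = common (subst (s <_) (proj₁ (∈-stableSubsets⁻ A∈)) s<) eq x∈A x∈C

    at : Subset n → Maybe (Fin n) → (Fin n → Formula V) → Formula V
    at A nothing  G = ⊥
    at A (just x) G = if does (x ∈? A) then G x else ⊥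

    at-just : ∀ {A m x G} → m ≡ just x → x ∈ₛ A → at A m G ≡ G x
    at-just {A} {x = x} refl x∈ with x ∈? A
    ... | yes _ = refl
    ... | no x∉ = contradiction x∈ x∉

    at-clash : ∀ {A C} m {G H Γ e} f →
      (∀ {x} → m ≡ just x → x ∈ₛ A → x ∈ₛ C → Γ ⊢[ e ] G x → Γ ⊢[ e ] H x → Γ ⊢[ f + e ] ⊥) →
      Γ ⊢[ e ] at A m G → Γ ⊢[ e ] at C m H → Γ ⊢[ f + e ] ⊥
    at-clash nothing f clash π ρ = up f π
    at-clash {A} {C} (just x) f clash π ρ with x ∈? A | x ∈? C
    ... | yes x∈A | yes x∈C = clash refl x∈A x∈C π ρ
    ... | no _    | _       = up f π
    ... | yes _   | no _    = up f ρ

    -- The pigeon A of colour i sits in the hole (i , s , t) if the first set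
    -- v of colour i meets A in its s-th element x, and the first set of
    -- colour i avoiding x meets A in its t-th element.
    seat₂ : Subset n → Fin c → Fin n → ℕ → Formula V
    seat₂ A i x t = atFirst (λ w → F w i) (avoiding x) (λ w → at A (nth w t) (λ _ → ∼ ⊥))

    seat₁ : Subset n → Fin c → ℕ × ℕ → Formula V
    seat₁ A i (s , t) = atFirst (λ v → F v i) L (λ v → at A (nth v s) (λ x → seat₂ A i x t))

    seat : Subset n → Fin c × ℕ × ℕ → Formula V
    seat A (i , st) = F A i ∧ seat₁ A i st

    -- The negation of all `Star` formulas in usable form: every colour occurs on a set avoiding any
    -- given x. The exponent 5 + e is what the indirect argument in `star-exists` yields.
    NonStar : List (Formula V) → Set
    NonStar Γ = ∀ {e} x i → Γ ⊢[ 5 + e ] ⋁ (λ w → F w i) (avoiding x)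

    module _ (k≤B : k ≤ B) (kk≤B : k * k ≤ B) where

      positions : List (ℕ × ℕ)
      positions = cartesianProduct (upTo k) (upTo k)

      length-upTo : ∀ m → length (upTo m) ≡ m
      length-upTo m = length-applyUpTo id m

      length-positions : length positions ≡ k * k
      length-positions = trans (length-cartesianProduct (upTo k) (upTo k))
        (cong₂ _*_ (length-upTo k) (length-upTo k))

      positions≤B : length positions ≤ B
      positions≤B = subst (_≤ B) (sym length-positions) kk≤B

      seat₂-some : ∀ {A i x e Γ} → Δ ⊆ Γ → A ∈ L → F A i ∈ Γ →
        Γ ⊢[ 5 + e ] ⋁ (λ w → F w i) (avoiding x) →
                   Γ ⊢[ 29 + e ] ⋁ (seat₂ A i x) (upTo k)
      seat₂-some {A} {i} {x} Δ⊆Γ A∈ FA∈ =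
        atFirst-some (λ w → F w i) (λ t w → at A (nth w t) (λ _ → ∼ ⊥))
        (avoiding x) (upTo k) (avoiding≤B x) (subst (_≤ B) (sym (length-upTo k)) k≤B)
        λ w∈ → meet Δ⊆Γ (proj₁ (∈-filter⁻ _ {xs = L} w∈)) A∈ FA∈ λ {t} t<k eq _ y∈A →
          ⋁I _ (subst (_≤ B) (sym (length-upTo k)) k≤B) (∈-upTo⁺ t<k)
             (subst (_ ⊢[ _ ]_) (sym (at-just eq y∈A)) (⇒I h₀))

      seat₁-some : ∀ {A i e Γ} → Δ ⊆ Γ → A ∈ L → F A i ∈ Γ → NonStar Γ →
        Γ ⊢[ 59 + e ] ⋁ (seat₁ A i) positions
      seat₁-some {A} {i} Δ⊆Γ A∈ FA∈ nonStar = atFirst-some (λ v → F v i)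
        (λ (s , t) v → at A (nth v s) (λ x → seat₂ A i x t)) L positions N≤B positions≤B
        (λ v∈ → meet Δ⊆Γ v∈ A∈ FA∈ λ {s} {x} s<k eq _ x∈A →
          ⋁E (seat₂ A i x) (upTo k) (subst (_≤ B) (sym (length-upTo k)) k≤B)
             (seat₂-some (there ∘ Δ⊆Γ) A∈ (there FA∈) (weaken there (nonStar x i))) λ t∈ →
               ⋁I _ positions≤B (∈-cartesianProduct⁺ (∈-upTo⁺ s<k) t∈)
                  (subst (_ ⊢[ _ ]_) (sym (at-just eq x∈A)) h₀))
        -- `A` itself shows that colour i occurs, so that a first set of this colour exists.
        (⋁I _ N≤B A∈ (assume FA∈))

      holes : List (Fin c × ℕ × ℕ)
      holes = cartesianProduct (allFin c) positions

      length-holes : length holes ≡ c * (k * k)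
      length-holes = trans (length-cartesianProduct (allFin c) positions)
        (cong₂ _*_ (length-allFin c) length-positions)

      seat-some : ∀ {A e Γ} → length holes ≤ B → Δ ⊆ Γ → A ∈ L → NonStar Γ →
        Γ ⊢[ 71 + e ] ⋁ (seat A) holes
      seat-some {A} holes≤B Δ⊆Γ A∈ nonStar =
        ⋁E (F A) (allFin c) colours≤B (weaken Δ⊆Γ (some-colour A∈)) λ {i} i∈ →
        ⋁E (seat₁ A i) positions positions≤B
           (seat₁-some (there ∘ Δ⊆Γ) A∈ (here refl) λ x i → weaken there (nonStar x i)) λ st∈ →
             ⋁I (seat A) holes≤B (∈-cartesianProduct⁺ i∈ st∈) (∧I h₁ h₀)

      -- A common hole means the same v, hence the same x, then the same w and the same element y of
      -- it. Since w avoids x, these are two distinct common elements of `A` and `C`.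
      seat-clash : ∀ {A C h e Γ} → (∀ {x y} → x ≢ y → x ∈ₛ A → y ∈ₛ A → x ∈ₛ C → y ∈ₛ C → Void) →
                   Γ ⊢[ 38 + e ] seat A h ⇒ ∼ seat C h
      seat-clash {A} {C} {i , s , t} unique = ⇒I (⇒I (atFirst-clash (λ v → F v i) _ _ L N≤B
        (λ {v} _ → at-clash (nth v s) 18
          (λ {x} _ x∈A x∈C → atFirst-clash (λ w → F w i) _ _ (avoiding x) (avoiding≤B x)
            λ {w} w∈ → at-clash (nth w t) 0
              (λ eq y∈A y∈C _ _ → void (unique
                (λ { refl → proj₂ (∈-filter⁻ _ {xs = L} w∈) (nth-sound w t eq) }) x∈A y∈A x∈C y∈C))
              h₁ h₀)
          h₁ h₀)
        (∧E₂ h₁) (∧E₂ h₀)))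

      crowded : ∀ {Γ} r → r * suc (k + k * k) ≤ n → c * (k * k) < r * r → r * r ≤ B → Δ ⊆ Γ →
        NonStar Γ → Γ ⊢[ 76 ] ⊥
      crowded {Γ} r r≤ holes<pigeons pigeons≤B Δ⊆Γ nonStar = ⟦ relax bound
        (cutColouring {e = 71} pigeons (pairs pigeons) holes (seat ∘ line n r k) ps≤B
          (≤-trans (length-pairs pigeons) (*-mono-≤ ps≤B ps≤B)) (<⇒≤ (≤-trans hs<ps ps≤B))
          (λ p∈ → seat-some {e = 0} (<⇒≤ (≤-trans hs<ps ps≤B)) Δ⊆Γ (line∈ p∈) nonStar)
          (λ {p} {q} pq∈ _ → seat-clash {e = 33} (different pq∈))
          (php pigeons holes (seat ∘ line n r k) hs<ps ps≤B)) ⟧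
        where
        pigeons = cartesianProduct (upTo r) (upTo r)
        length-pigeons : length pigeons ≡ r * r
        length-pigeons = trans (length-cartesianProduct (upTo r) (upTo r))
          (cong₂ _*_ (length-upTo r) (length-upTo r))
        ps≤B : length pigeons ≤ B
        ps≤B = subst (_≤ B) (sym length-pigeons) pigeons≤B
        hs<ps : length holes < length pigeons
        hs<ps = subst₂ _<_ (sym length-holes) (sym length-pigeons) holes<pigeons
        small : ∀ {p} → p ∈ pigeons → proj₁ p < r × proj₂ p < r
        small p∈ with ∈-cartesianProduct⁻ (upTo r) (upTo r) p∈
        ... | a∈ , b∈ = ∈-upTo⁻ a∈ , ∈-upTo⁻ b∈
        line∈ : ∀ {p} → p ∈ pigeons → line n r k p ∈ L
        line∈ p∈ with small p∈
        ... | a<r , b<r = ∈-stableSubsets⁺ (line-vertex 1≤k r≤ a<r b<r)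
        different : ∀ {p q x y} → (p , q) ∈ pairs pigeons → x ≢ y → x ∈ₛ line n r k p →
          y ∈ₛ line n r k p →
                    x ∈ₛ line n r k q → y ∈ₛ line n r k q → Void
        different pq∈ x≢y x∈p y∈p x∈q y∈q with ∈-pairs⁻ pq∈
        ... | p∈ , q∈ with small p∈ | small q∈
        ...   | a<r , b<r | a′<r , b′<r = pairs-AllPairs (cartesianProduct⁺ (upTo⁺ r) (upTo⁺ r)) pq∈
          (line-unique {k = k} a<r b<r a′<r b′<r x≢y x∈p y∈p x∈q y∈q)
        bound : B ^ 75 + (length holes * B ^ 21 + B ^ 21) ≤ B ^ 76
        bound = begin
          B ^ 75 + (length holes * B ^ 21 + B ^ 21)
            ≡⟨ cong (B ^ 75 +_) (+-comm (length holes * B ^ 21) (B ^ 21)) ⟩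
          B ^ 75 + suc (length holes) * B ^ 21
            ≤⟨ +-monoʳ-≤ (B ^ 75) (*-monoˡ-≤ (B ^ 21) (≤-trans hs<ps ps≤B)) ⟩
          B ^ 75 + B ^ 22                            ≤⟨ +-monoʳ-≤ (B ^ 75) (^-monoʳ-≤ B (m≤m+n 22 53)) ⟩
          B ^ 75 + B ^ 75                            ≤⟨ +-monoʳ-≤ (B ^ 75) (m≤m+n _ _) ⟩
          5 * B ^ 75                                 ≤⟨ 5*≤ 75 ⟩
          B ^ 76                                     ∎
          where
          open ≤-Reasoning
          instance
            B-nonZero : NonZero B
            B-nonZero = >-nonZero (≤-trans (s≤s z≤n) 5≤B)

      -- An empty colour class counts as a star with any centre.
      Star : Fin n × Fin c → Formula V
      Star (x , i) = ∼ ⋁ (λ w → F w i) (avoiding x)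

      centres : List (Fin n × Fin c)
      centres = cartesianProduct (allFin n) (allFin c)

      star-exists : ∀ r → r * suc (k + k * k) ≤ n → c * (k * k) < r * r → r * r ≤ B →
        length centres ≤ B →
                    Δ ⊢[ 78 ] ⋁ Star centres
      star-exists r r≤ holes<pigeons pigeons≤B centres≤B =
        RAA (crowded r r≤ holes<pigeons pigeons≤B there λ x i →
          RAA (h₁ · ⋁I Star centres≤B (∈-cartesianProduct⁺ (∈-allFin x) (∈-allFin i)) h₀))

-- The refutation of a colouring

search : ∀ {A : Set} {P Q : A → Set} xs → (∀ {x} → x ∈ xs → P x ⊎ Q x) →
         (∃ λ x → x ∈ xs × P x) ⊎ (∀ {x} → x ∈ xs → Q x)
search []       decide = inj₂ λ ()
search (x ∷ xs) decide with decide (here refl) | search xs (decide ∘ there)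
... | inj₁ px | _                    = inj₁ (x , here refl , px)
... | inj₂ _  | inj₁ (y , y∈ , py)   = inj₁ (y , there y∈ , py)
... | inj₂ qx | inj₂ qxs             = inj₂ λ { (here refl) → qx ; (there x∈) → qxs x∈ }

length-subsets : ∀ n → length (subsets n) ≡ 2 ^ n
length-subsets zero    = refl
length-subsets (suc n) = trans (length-++ (map (inside Vec.∷_) (subsets n)))
  (cong₂ _+_ (trans (length-map _ (subsets n)) (length-subsets n))
             (trans (length-map _ (subsets n)) (trans (length-subsets n) (sym (+-identityʳ _)))))

length-disjointPairs : ∀ n k {B} → length (stableSubsets n k) ≤ B → length (disjointPairs n k) ≤ B * B
length-disjointPairs n k N≤B =
  ≤-trans (length-filter _ (cartesianProduct (stableSubsets n k) (stableSubsets n k)))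
  (≤-trans (≤-reflexive (length-cartesianProduct (stableSubsets n k) (stableSubsets n k)))
    (*-mono-≤ N≤B N≤B))

∈-disjointPairs⁻ : ∀ n k {A C} → (A , C) ∈ disjointPairs n k →
  A ∈ stableSubsets n k × C ∈ stableSubsets n k × Empty (A ∩ C)
∈-disjointPairs⁻ n k AC∈ with ∈-filter⁻ (λ (A , C) → ¬? (nonempty? (A ∩ C)))
                                 {xs = cartesianProduct (stableSubsets n k) (stableSubsets n k)} AC∈
... | AC∈′ , empty with ∈-cartesianProduct⁻ (stableSubsets n k) (stableSubsets n k) AC∈′
...   | A∈ , C∈ = A∈ , C∈ , empty

-- The factor from `line-vertex`: start below r, and k steps of at most r k + r, fit into r (1 + k +
-- k²) elements.
block : ℕ → ℕ
block k = suc (k + k * k)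

-- Let a be `block k` times k². Above the second summand, r = n / `block k` is at least 2 a, so c k²
-- < (r + 1) a ≤ 2 r a ≤ r² and pigeons outnumber holes. The first summand ensures that at least two
-- colours are present, so that one may be removed.
threshold : ℕ → ℕ
threshold k = suc (2 * k) + block k * (2 * (block k * (k * k))) 

module Refuting (B : ℕ) (5≤B : 5 ≤ B) {V : Set} (k : ℕ) (1≤k : 1 ≤ k) (kk≤B : k * k ≤ B) where
  open Calculus B 5≤B {V}
  open Pigeonhole B 5≤B {V}
  open Reduction B 5≤B {V} k 1≤k

  k≤B : k ≤ B
  k≤B = ≤-trans (≤-trans (≤-reflexive (sym (*-identityʳ k))) (*-monoʳ-≤ k 1≤k)) kk≤B

  module _ {n c : ℕ} (F : Subset n → Fin c → Formula V)
           (N≤B : length (stableSubsets n k) ≤ B) (c≤B : c ≤ B)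
           (1≤c : 1 ≤ c) (c+2k : c + 2 * k ≡ suc n) where

    private
      L = stableSubsets n k
      Δ = theory n k c F

    -- A vertex with all colours denied contradicts its axiom. Otherwise a colouring can be read off
    -- from Γ; `schrijver` makes it improper, and a search through the disjoint pairs finds the
    -- violated axiom.
    brute-leaf : ∀ {Γ} → Δ ⊆ Γ → (∀ {A} → A ∈ L → ∀ i → F A i ∈ Γ ⊎ ∼ F A i ∈ Γ) → Γ ⊢[ 7 ] ⊥
    brute-leaf {Γ} Δ⊆Γ decide with search {P = λ A → ∀ i → ∼ F A i ∈ Γ} {Q = λ A → ∃ λ i → F A i ∈ Γ} L
      colourless?
      where
      colourless? : ∀ {A} → A ∈ L → (∀ i → ∼ F A i ∈ Γ) ⊎ ∃ λ i → F A i ∈ Γ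
      colourless? A∈ with search {P = λ i → F _ i ∈ Γ} {Q = λ i → ∼ F _ i ∈ Γ} (allFin c)
                            (λ {i} _ → decide A∈ i)
      ... | inj₁ (i , _ , FAi) = inj₂ (i , FAi)
      ... | inj₂ none          = inj₁ λ i → none (∈-allFin i)
    ... | inj₁ (A , A∈ , none) =
          ⋁E (F A) (allFin c) (colours≤B F N≤B c≤B) (weaken Δ⊆Γ (some-colour F N≤B c≤B A∈))
                                    λ {i} _ → assume (there (none i)) · h₀
    ... | inj₂ coloured = conclude (search (disjointPairs n k) λ {(A , C)} _ → equal? A C)
      where
      colour : Subset n → ℕ
      colour A with isVertex? k A
      -- Colours are shifted to start at 1, as `schrijver` expects; 0 is the default outside the
      -- vertices.
      ... | yes v = suc (toℕ (proj₁ (coloured (∈-stableSubsets⁺ v))))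
      ... | no  _ = 0
      colour-spec : ∀ {A} → A ∈ L → ∃ λ i → colour A ≡ suc (toℕ i) × F A i ∈ Γ
      colour-spec {A} A∈ with isVertex? k A
      ... | yes v = proj₁ (coloured (∈-stableSubsets⁺ v)) , refl , proj₂ (coloured (∈-stableSubsets⁺ v))
      ... | no ¬v = contradiction (∈-stableSubsets⁻ A∈) ¬v
      equal? : ∀ A C → colour A ≡ colour C ⊎ colour A ≢ colour C
      equal? A C with colour A ≟ colour C
      ... | yes eq = inj₁ eq
      ... | no  ne = inj₂ ne
      range : ∀ A → IsVertex k A → 1 ≤ colour A × colour A ≤ c
      range A v with colour-spec (∈-stableSubsets⁺ v)
      ... | i , eq , _ = subst (1 ≤_) (sym eq) (s≤s z≤n) , subst (_≤ c) (sym eq) (toℕ<n i)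
      improper : (∀ {AC} → AC ∈ disjointPairs n k → colour (proj₁ AC) ≢ colour (proj₂ AC)) → ∀ n′ →
        suc n′ ≡ n → Void
      improper distinct n′ refl = schrijver 1≤k 1≤c c+2k colour range λ A C vA vC empty →
        distinct (∈-filter⁺ _ (∈-cartesianProduct⁺ (∈-stableSubsets⁺ vA) (∈-stableSubsets⁺ vC)) empty)
      1≤n : 1 ≤ n
      1≤n = s≤s⁻¹ (subst (2 ≤_) c+2k (+-mono-≤ 1≤c (≤-trans 1≤k (m≤m+n k _))))
      conclude : (∃ λ AC → AC ∈ disjointPairs n k × colour (proj₁ AC) ≡ colour (proj₂ AC)) ⊎
                 (∀ {AC} → AC ∈ disjointPairs n k → colour (proj₁ AC) ≢ colour (proj₂ AC)) → Γ ⊢[ 7 ] ⊥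
      conclude (inj₂ distinct) = void (improper distinct _ (suc-pred n))
        where instance _ = >-nonZero 1≤n
      conclude (inj₁ ((A , C) , AC∈ , eq)) with ∈-disjointPairs⁻ n k AC∈
      ... | A∈ , C∈ , empty with colour-spec A∈ | colour-spec C∈
      ...   | i , eqA , FAi | j , eqC , FCj with toℕ-injective
            (suc-injective (trans (sym eqA) (trans eq eqC)))
      ...     | refl = weaken Δ⊆Γ (proper-colour F N≤B c≤B A∈ C∈ empty) · assume FAi · assume FCj

    -- A decision tree over all colour formulas. Each split by `EM` adds 6 to the exponent, which is
    -- affordable because below the threshold the number of splits is bounded in terms of k.
    brute : ∀ todo {Γ} → Δ ⊆ Γ → (∀ {A} → A ∈ L → ∀ i → (A , i) ∈ todo ⊎ F A i ∈ Γ ⊎ ∼ F A i ∈ Γ) →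
            Γ ⊢[ length todo * 6 + 7 ] ⊥
    brute [] Δ⊆Γ decide = brute-leaf Δ⊆Γ λ A∈ i → decided (decide A∈ i)
      where
      decided : ∀ {P : Set} {p : Subset n × Fin c} → p ∈ [] ⊎ P → P
      decided (inj₂ p) = p
    brute ((A , i) ∷ todo) {Γ} Δ⊆Γ decide = EM (F A i)
      (brute todo (there ∘ Δ⊆Γ) λ C∈ j → advance (inj₁ (here refl)) (decide C∈ j))
      (brute todo (there ∘ Δ⊆Γ) λ C∈ j → advance (inj₂ (here refl)) (decide C∈ j))
      where
      advance : ∀ {D C j} → F A i ∈ D ∷ Γ ⊎ ∼ F A i ∈ D ∷ Γ →
        (C , j) ∈ (A , i) ∷ todo ⊎ F C j ∈ Γ ⊎ ∼ F C j ∈ Γ →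
                (C , j) ∈ todo ⊎ F C j ∈ D ∷ Γ ⊎ ∼ F C j ∈ D ∷ Γ
      advance new (inj₁ (here refl))  = inj₂ new
      advance new (inj₁ (there ∈todo)) = inj₁ ∈todo
      advance new (inj₂ (inj₁ ∈Γ))    = inj₂ (inj₁ (there ∈Γ))
      advance new (inj₂ (inj₂ ∈Γ))    = inj₂ (inj₂ (there ∈Γ))

    base : ∀ {E} → length L * c * 6 + 7 ≤ E → Δ ⊢⟨ B ^ E ⟩ ⊥
    base {E} le = relax (≤-trans
      (≤-reflexive (cong (λ l → B ^ (l * 6 + 7))
      (trans (length-cartesianProduct L (allFin c)) (cong (length L *_) (length-allFin c)))))
                                 (^-monoʳ-≤ B le))
      (unwrap (brute (cartesianProduct L (allFin c)) id λ A∈ i →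
        inj₁ (∈-cartesianProduct⁺ A∈ (∈-allFin i))))
      where instance _ = >-nonZero (≤-trans (s≤s z≤n) 5≤B)

  -- Removes the centre x and the colour i of the first star-shaped colour class.
  reduce : ∀ {n c s} (F : Subset (suc n) → Fin (suc c) → Formula V) r →
    r * block k ≤ suc n → suc c * (k * k) < r * r → r * r ≤ B → suc n * suc c ≤ B → suc c ≤ B →
    length (stableSubsets (suc n) k) ≤ B →
    (∀ F′ → theory n k c F′ ⊢⟨ s ⟩ ⊥) → theory (suc n) k (suc c) F ⊢⟨ B ^ 106 + s ⟩ ⊥
  reduce {n} {c} F r r≤ holes<pigeons pigeons≤B nc≤B c≤B N≤B π =
    cutColouring {e = 102} (stableSubsets n k) (disjointPairs n k) (allFin c) F′
      N′≤B (length-disjointPairs n k N′≤B) c′≤B some proper (π F′)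
    where
    Δ = theory (suc n) k (suc c) F
    star    = Star F N≤B c≤B k≤B kk≤B
    centre  = centres F N≤B c≤B k≤B kk≤B
    F′ : Subset n → Fin c → Formula V
    F′ A j = atFirst star centre (λ (x , i) → F (extend x A) (punchIn i j))
    N′≤B : length (stableSubsets n k) ≤ B
    N′≤B = ≤-trans (length-stableSubsets-mono n k) N≤B
    c′≤B : length (allFin c) ≤ B
    c′≤B = subst (_≤ B) (sym (length-allFin c)) (<⇒≤ c≤B)
    centres≤B : length centre ≤ B
    centres≤B = subst (_≤ B) (sym (trans (length-cartesianProduct (allFin (suc n)) (allFin (suc c)))
                                         (cong₂ _*_ (length-allFin (suc n)) (length-allFin (suc c)))))
                                           nc≤B
    extend∈ : ∀ {A} x → A ∈ stableSubsets n k → extend x A ∈ stableSubsets (suc n) k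
    extend∈ x A∈ = ∈-stableSubsets⁺ (extend-vertex x (∈-stableSubsets⁻ A∈))
    some : ∀ {A} → A ∈ stableSubsets n k → Δ ⊢[ 102 ] ⋁ (F′ A) (allFin c)
    some {A} A∈ = atFirst-some star (λ j (x , i) → F (extend x A) (punchIn i j)) centre (allFin c)
      centres≤B c′≤B
      (λ {(x , i)} _ → ⋁E (F (extend x A)) (allFin (suc c)) (colours≤B F N≤B c≤B)
        (weaken there (some-colour F N≤B c≤B (extend∈ x A∈))) λ {i′} _ → other x i i′ (i ≟ᶠ i′))
      (star-exists F N≤B c≤B k≤B kk≤B r r≤ holes<pigeons pigeons≤B centres≤B)
      where
      other : ∀ x i i′ → Dec (i ≡ i′) → F (extend x A) i′ ∷ star (x , i) ∷ Δ ⊢[ 72 ]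
              ⋁ (λ j → F (extend x A) (punchIn i j)) (allFin c)
      -- The extended set avoids x, so having colour i would contradict that x is the centre of this
      -- class.
      other x i i′ (yes refl) = ⊥E (h₁ · ⋁I (λ w → F w i) (avoiding≤B F N≤B c≤B x)
                                            (∈-filter⁺ _ (extend∈ x A∈) (∉-extend x A)) h₀)
      other x i i′ (no i≢i′)  = ⋁I (λ j → F (extend x A) (punchIn i j)) c′≤B (∈-allFin (punchOut i≢i′))
        (subst (λ i″ → _ ⊢[ _ ] F (extend x A) i″) (sym (punchIn-punchOut i≢i′)) h₀)
    proper : ∀ {A C j} → (A , C) ∈ disjointPairs n k → j ∈ allFin c → Δ ⊢[ 102 ] F′ A j ⇒ ∼ F′ C j
    proper {A} {C} {j} AC∈ _ = ⇒I (⇒I (atFirst-clash star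
      (λ (x , i) → F (extend x A) (punchIn i j)) (λ (x , i) → F (extend x C) (punchIn i j)) centre
        centres≤B
      (λ {(x , i)} _ → weaken (there ∘ there ∘ there ∘ there ∘ there) (clash x i) · h₁ · h₀)
      h₁ h₀))
      where
      clash : ∀ {e} x i → Δ ⊢[ e ] F (extend x A) (punchIn i j) ⇒ ∼ F (extend x C) (punchIn i j)
      clash x i = let A∈ , C∈ , empty = ∈-disjointPairs⁻ n k AC∈ in
        proper-colour F N≤B c≤B (extend∈ x A∈) (extend∈ x C∈) (extend-disjoint x empty)

  baseExponent : ℕ
  baseExponent = 2 ^ threshold k * threshold k * 6 + 7

  -- A reduction lowers n and c together, which preserves `c + 2 * k ≡ suc n`, and `B` can stay
  -- fixed because all lists only get shorter.
  refute : ∀ n c (F : Subset n → Fin c → Formula V) → 1 ≤ c → c + 2 * k ≡ suc n →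
    length (stableSubsets n k) ≤ B → n * n ≤ B → theory n k c F ⊢⟨ n * B ^ 106 + B ^ baseExponent ⟩ ⊥
  refute n c F 1≤c c+2k N≤B nn≤B with threshold k ≤? n
  ... | no n≱t = relax (m≤n+m _ (n * B ^ 106)) (base F N≤B (≤-trans c≤n (≤-trans n≤nn nn≤B)) 1≤c c+2k
          (+-monoˡ-≤ 7 (*-monoˡ-≤ 6 (*-mono-≤ N≤2^t (≤-trans c≤n n≤t)))))
    where
    n≤t : n ≤ threshold k
    n≤t = <⇒≤ (≰⇒> n≱t)
    c≤n : c ≤ n
    c≤n = s≤s⁻¹ (subst (suc c ≤_) c+2k
      (≤-trans (≤-reflexive (+-comm 1 c)) (+-monoʳ-≤ c (≤-trans 1≤k (m≤m+n k _)))))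
    n≤nn : n ≤ n * n
    n≤nn = ≤-trans (≤-reflexive (sym (*-identityʳ n))) (*-monoʳ-≤ n (≤-trans 1≤c c≤n))
    N≤2^t : length (stableSubsets n k) ≤ 2 ^ threshold k
    N≤2^t = ≤-trans (length-filter (isVertex? k) (subsets n))
              (≤-trans (≤-reflexive (length-subsets n)) (^-monoʳ-≤ 2 n≤t))
  refute zero    c             F 1≤c c+2k N≤B nn≤B | yes ()
  refute (suc n) zero          F () c+2k N≤B nn≤B | yes _
  -- A single colour means a ground set of 2 k elements, which is below the threshold.
  refute (suc n) (suc zero)    F 1≤c c+2k N≤B nn≤B | yes t≤n =
    contradiction (≤-trans (m≤m+n (suc (2 * k)) _) t≤n)
      (<⇒≱ (s≤s (≤-reflexive (sym (suc-injective c+2k)))))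
  refute (suc n) (suc (suc c)) F 1≤c c+2k N≤B nn≤B | yes t≤n =
    relax (≤-reflexive (sym (+-assoc (B ^ 106) (n * B ^ 106) _)))
      (reduce F r r*q≤n c*kk<r*r (≤-trans (*-mono-≤ r≤n r≤n) nn≤B)
        (≤-trans (*-monoʳ-≤ (suc n) c≤n) nn≤B) (≤-trans c≤n (≤-trans (m≤m+n (suc n) _) nn≤B)) N≤B
        λ F′ → refute n (suc c) F′ (s≤s z≤n) (suc-injective c+2k)
          (≤-trans (length-stableSubsets-mono n k) N≤B)
                      (≤-trans (*-mono-≤ (n≤1+n n) (n≤1+n n)) nn≤B))
    where
    q = block k
    r = suc n / q
    kk = k * k
    a = q * kk
    r*q≤n : r * q ≤ suc n
    r*q≤n = m/n*n≤m (suc n) q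
    r≤n : r ≤ suc n
    r≤n = ≤-trans (≤-trans (≤-reflexive (sym (*-identityʳ r))) (*-monoʳ-≤ r (s≤s z≤n))) r*q≤n
    c≤n : suc (suc c) ≤ suc n
    c≤n = s≤s⁻¹ (subst (suc (suc (suc c)) ≤_) c+2k
            (≤-trans (≤-reflexive (+-comm 1 (suc (suc c))))
              (+-monoʳ-≤ (suc (suc c)) (≤-trans 1≤k (m≤m+n k _)))))
    1≤kk : 1 ≤ kk
    1≤kk = *-mono-≤ 1≤k 1≤k
    2a≤r : 2 * a ≤ r
    2a≤r = ≤-trans (≤-reflexive (sym (trans (cong (_/ q) (*-comm q (2 * a))) (m*n/n≡m (2 * a) q))))
                   (/-monoˡ-≤ q (≤-trans (m≤n+m (q * (2 * a)) (suc (2 * k))) t≤n))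
    1≤r : 1 ≤ r
    1≤r = ≤-trans (*-mono-≤ {1} {2} (s≤s z≤n) (*-mono-≤ {1} {q} (s≤s z≤n) 1≤kk)) 2a≤r
    n<[1+r]q : suc n < suc r * q
    n<[1+r]q = ≤-trans (s≤s (≤-reflexive (m≡m%n+[m/n]*n (suc n) q)))
      (+-monoˡ-≤ (r * q) (m%n<n (suc n) q))
    c*kk<r*r : suc (suc c) * kk < r * r
    c*kk<r*r = begin
      suc (suc (suc c) * kk)       ≤⟨ +-monoˡ-≤ _ 1≤kk ⟩
      suc (suc (suc c)) * kk       ≤⟨ *-monoˡ-≤ kk (≤-trans (s≤s c≤n) n<[1+r]q) ⟩
      suc r * q * kk               ≡⟨ *-assoc (suc r) q kk ⟩
      a + r * a
        ≤⟨ +-monoˡ-≤ (r * a) (≤-trans (≤-reflexive (sym (*-identityˡ a))) (*-monoˡ-≤ a 1≤r)) ⟩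
      r * a + r * a                ≡⟨ solve 2 (λ r a → r :* a :+ r :* a := r :* (con 2 :* a)) refl r a ⟩
      r * (2 * a)                  ≤⟨ *-monoʳ-≤ r 2a≤r ⟩
      r * r                        ∎
      where
      open ≤-Reasoning
      open +-*-Solver

-- The formulas Schrijver n k

∈-pairs-tabulate : ∀ {A : Set} {n} (f : Fin n → A) {i j} → i <ᶠ j → (f i , f j) ∈ pairs (tabulate f)
∈-pairs-tabulate f {zero}  {suc j} i<j       = ∈-++⁺ˡ (∈-map⁺ (f zero ,_) (∈-tabulate⁺ j))
∈-pairs-tabulate f {suc i} {suc j} (s≤s i<j) =
  ∈-++⁺ʳ (map (f zero ,_) (tabulate (f ∘ suc))) (∈-pairs-tabulate (f ∘ suc) i<j)

∥++∥ : ∀ {V} (F G : CNF V) → ∥ F ++ G ∥ ≡ ∥ F ∥ + ∥ G ∥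
∥++∥ F G = trans (cong sum (map-++ length F G)) (sum-++ (map length F) (map length G))

∥map∥ : ∀ {V A : Set} (f : A → Clause V) m → (∀ a → length (f a) ≡ m) → ∀ as →
  ∥ map f as ∥ ≡ length as * m
∥map∥ f m eq []       = refl
∥map∥ f m eq (a ∷ as) = cong₂ _+_ (eq a) (∥map∥ f m eq as)

-- A derivation contains ⊥ somewhere, but a refutation must end with it. Two lines produce `⊥ ⇒ ⊥`,
-- and a third repeats ⊥ at the end.
toRefutation : ∀ {V} {F : CNF V} {s} → map clauseFormula F ⊢⟨ s ⟩ ⊥ → Σ (Refutation F) λ π →
  size π ≤ 3 + s
toRefutation (derivation {ls} π ⊥∈ short) =
  ((⊥ ⇒ ⊥) ∷ (⊥ ⇒ ⊥ ⇒ ⊥) ∷ ls ,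
   mp (here refl) (there (there ⊥∈)) (mp (here refl) (there ⊥∈) (axiom (K ⊥ ⊥) π))) ,
  s≤s (s≤s (s≤s short))

^-distribʳ-* : ∀ d x y → (x * y) ^ d ≡ x ^ d * y ^ d
^-distribʳ-* zero    x y = refl
^-distribʳ-* (suc d) x y = trans (cong (x * y *_) (^-distribʳ-* d x y))
  (solve 4 (λ x y u v → x :* y :* (u :* v) := x :* u :* (y :* v)) refl x y (x ^ d) (y ^ d))
  where open +-*-Solver

monomial : ℕ → ℕ → Polynomial
monomial a zero    = [ a ]
monomial a (suc d) = 0 ∷ monomial a d

eval-monomial : ∀ a d x → eval (monomial a d) x ≡ x ^ d * a
eval-monomial a zero    x =
  trans (cong (a +_) (*-zeroʳ x)) (trans (+-identityʳ a) (sym (+-identityʳ a)))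
eval-monomial a (suc d) x = trans (cong (x *_) (eval-monomial a d x)) (sym (*-assoc x (x ^ d) a))

module _ (n k : ℕ) (1≤k : 1 ≤ k) (2k≤n : 2 * k ≤ n) where

  private
    L = stableSubsets n k
    N = length L
    c = n ∸ 2 * k + 1
    V = SchrijverVar n k
    Γ = map clauseFormula (Schrijver n k)

  1≤colours : 1 ≤ c
  1≤colours = m≤n+m 1 (n ∸ 2 * k)

  colours+2k : c + 2 * k ≡ suc n
  colours+2k = trans (cong (_+ 2 * k) (+-comm (n ∸ 2 * k) 1)) (cong suc (m∸n+n≡m 2k≤n))

  1≤vertices : 1 ≤ N
  1≤vertices = nonempty (∈-stableSubsets⁺ {A = progression 1 0 k n} (∣progression∣ 1 0 k n fits ,
                 spread⇒stable false _ (spread-progression 1 0 k n (s≤s z≤n) fits)))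
    where
    fits : 0 + k * 2 ≤ n
    fits = ≤-trans (≤-reflexive (*-comm k 2)) 2k≤n
    nonempty : ∀ {A : Set} {x : A} {xs} → x ∈ xs → 1 ≤ length xs
    nonempty (here _)  = s≤s z≤n
    nonempty (there _) = s≤s z≤n

  Nc≤size : N * c ≤ ∥ Schrijver n k ∥
  Nc≤size = begin
    N * c                     ≡⟨ cong (_* c) (length-allFin N) ⟨
    length (allFin N) * c
      ≡⟨ ∥map∥ _ c (λ v → trans (length-map _ (allFin c)) (length-allFin c)) (allFin N) ⟨
    ∥ some ∥                  ≤⟨ m≤m+n ∥ some ∥ _ ⟩
    ∥ some ∥ + ∥ rest ∥       ≡⟨ ∥++∥ some rest ⟨
    ∥ some ++ rest ∥          ≤⟨ m≤n+m _ ∥ graph ∥ ⟩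
    ∥ graph ∥ + ∥ some ++ rest ∥  ≡⟨ ∥++∥ graph (some ++ rest) ⟨
    ∥ Schrijver n k ∥         ∎
    where
    open ≤-Reasoning
    graph = graphClauses (skAdjacent? n k) c
    some  = someColour (skAdjacent? n k) c
    rest  = uniqueColour (skAdjacent? n k) c ++ properColour (skAdjacent? n k) c

  colours≤size : c ≤ ∥ Schrijver n k ∥
  colours≤size = ≤-trans (≤-trans (≤-reflexive (sym (*-identityˡ c))) (*-monoˡ-≤ c 1≤vertices)) Nc≤size

  vertices≤size : N ≤ ∥ Schrijver n k ∥
  vertices≤size = ≤-trans (≤-trans (≤-reflexive (sym (*-identityʳ N))) (*-monoʳ-≤ N 1≤colours)) Nc≤size

  -- Indexed by sets, since the reductions change the ground set and with it the numbering of
  -- vertices; ⊥ is the default outside the vertices.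
  hasColour : Subset n → Fin c → Formula V
  hasColour A i with isVertex? k A
  ... | yes v = var (X (Any.index (∈-stableSubsets⁺ v)) i)
  ... | no  _ = ⊥

  hasColour-spec : ∀ {A} → A ∈ L → ∃ λ v → List.lookup L v ≡ A × ∀ i → hasColour A i ≡ var (X v i)
  hasColour-spec {A} A∈ with isVertex? k A
  ... | yes v = Any.index (∈-stableSubsets⁺ v) , sym (lookup-index (∈-stableSubsets⁺ v)) , λ _ → refl
  ... | no ¬v = contradiction (∈-stableSubsets⁻ A∈) ¬v

  module Translation (B : ℕ) (5≤B : 5 ≤ B) (c≤B : c ≤ B) where
    open Calculus B 5≤B {V}

    someColour∈ : ∀ v → clauseFormula (map (λ i → pos (X v i)) (allFin c)) ∈ Γ
    someColour∈ v = ∈-map⁺ clauseFormula (∈-++⁺ʳ (graphClauses (skAdjacent? n k) c) (∈-++⁺ˡ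
      (∈-map⁺ (λ v → map (λ i → pos (X v i)) (allFin c)) (∈-allFin v))))

    edge∈ : ∀ {v w} → v <ᶠ w → SKAdjacent n k v w → var (Y v w) ∈ Γ
    edge∈ {v} {w} v<w adj =
      subst (λ b → literalFormula (if b then pos (Y v w) else neg (Y v w)) ∈ Γ)
        (dec-true (skAdjacent? n k v w) adj)
        (∈-map⁺ clauseFormula (∈-++⁺ˡ (∈-map⁺
          (λ (v , w) → [ (if does (skAdjacent? n k v w) then pos (Y v w) else neg (Y v w)) ])
          (∈-pairs-tabulate id v<w))))

    properColour∈ : ∀ {v w} i → v <ᶠ w → (∼ var (Y v w)) ∨ (∼ var (X v i)) ∨ (∼ var (X w i)) ∈ Γ
    properColour∈ {v} {w} i v<w = ∈-map⁺ clauseFormula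
      (∈-++⁺ʳ (graphClauses (skAdjacent? n k) c)
        (∈-++⁺ʳ (someColour (skAdjacent? n k) c) (∈-++⁺ʳ (uniqueColour (skAdjacent? n k) c)
        (∈-concatMap⁺ (λ (v , w) → map (λ i → neg (Y v w) ∷ neg (X v i) ∷ neg (X w i) ∷ []) (allFin c))
          (Any.map (λ { refl → ∈-map⁺ _ (∈-allFin i) }) (∈-pairs-tabulate id v<w))))))

    -- The two formulas differ at the end only: a nonempty clause stops at its last literal, `⋁` at
    -- an extra ⊥. The induction has no premises for single entries, so the trivial `∼ ⊥` takes
    -- their place.
    clause⇒⋁ : ∀ {e Δ} v is → length is ≤ B →
      Δ ⊢[ 9 + e ] clauseFormula (map (λ i → pos (X v i)) is) ⇒ ⋁ (λ i → var (X v i)) is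
    clause⇒⋁ v is is≤B = fold (λ _ → ∼ ⊥)
      (λ is → clauseFormula (map (λ i → pos (X v i)) is) ⇒ ⋁ (λ i → var (X v i)) is)
      (⇒I h₀)
      (λ { i [] → ⇒I (∨I₁ h₀) ; i (_ ∷ _) → ⇒I (∨E h₀ (∨I₁ h₀) (∨I₂ (h₃ · h₀))) })
      is is≤B λ _ → ⇒I h₀

    hasColour-some : ∀ {e A} → A ∈ L → Γ ⊢[ 10 + e ] ⋁ (hasColour A) (allFin c)
    hasColour-some {A = A} A∈ = subst (Γ ⊢[ _ ]_) (⋁-cong (allFin c))
      (clause⇒⋁ v (allFin c) (subst (_≤ B) (sym (length-allFin c)) c≤B) · assume (someColour∈ v))
      where
      v  = proj₁ (hasColour-spec A∈)
      eq = proj₂ (proj₂ (hasColour-spec A∈))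
      ⋁-cong : ∀ is → ⋁ (λ i → var (X v i)) is ≡ ⋁ (hasColour A) is
      ⋁-cong []       = refl
      ⋁-cong (i ∷ is) = cong₂ _∨_ (sym (eq i)) (⋁-cong is)

    hasColour-proper : ∀ {e A C i} → A ∈ L → C ∈ L → Empty (A ∩ C) →
      Γ ⊢[ 11 + e ] hasColour A i ⇒ ∼ hasColour C i
    hasColour-proper {i = i} A∈ C∈ empty =
      let v , v≡ , eq = hasColour-spec A∈; w , w≡ , eq′ = hasColour-spec C∈ in
      subst₂ (λ P Q → Γ ⊢[ _ ] P ⇒ ∼ Q) (sym (eq i)) (sym (eq′ i))
        (clash v w (subst₂ (λ A C → Empty (A ∩ C)) (sym v≡) (sym w≡) empty) (<ᶠ-cmp v w))
      where
      clash : ∀ {e} v w → SKAdjacent n k v w → Tri (v <ᶠ w) (v ≡ w) (w <ᶠ v) →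
              Γ ⊢[ 11 + e ] var (X v i) ⇒ ∼ var (X w i)
      clash v w adj (tri< v<w _ _) = ⇒I (⇒I (∨E (assume (there (there (properColour∈ i v<w))))
        (h₀ · assume (there (there (there (edge∈ v<w adj)))))
        (∨E h₀ (h₀ · h₃) (h₀ · h₂))))
      clash v w adj (tri> _ _ w<v) = ⇒I (⇒I (∨E (assume (there (there (properColour∈ i w<v))))
        (h₀ · assume (there (there (there (edge∈ w<v adj′)))))
        (∨E h₀ (h₀ · h₂) (h₀ · h₃))))
        where adj′ = subst Empty (∩-comm (List.lookup L v) (List.lookup L w)) adj
      clash v .v adj (tri≈ _ refl _) = contradiction (begin
          1                     ≤⟨ 1≤k ⟩
          k                     ≡⟨ proj₁ (∈-stableSubsets⁻ {n} {k} (∈-lookup v)) ⟨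
          ∣ List.lookup L v ∣
            ≡⟨ cong ∣_∣ (Empty-unique (subst Empty (∩-idem (List.lookup L v)) adj)) ⟩
          ∣ ∅ {n} ∣             ≡⟨ ∣⊥∣≡0 n ⟩
          0                     ∎) λ ()
        where open ≤-Reasoning

-- Added to the formula size s, it gives a bound on 5, k and n at once, because n + 1 = c + 2 k and
-- c ≤ s.
width : ℕ → ℕ
width k = 2 * k + 5

-- The total is at most B to the power 3 + 106 + M, with M the brute-force exponent; the factor 2
-- comes from B being a square.
degree : ℕ → ℕ
degree k = 2 * suc (suc (suc (106 + (2 ^ threshold k * threshold k * 6 + 7))))

corollary1 : ∀ (k : ℕ) → 1 ≤ k →
    Σ Polynomial λ p →
    ∀ (n : ℕ) → 2 * k ≤ n →
    Σ (Refutation (Schrijver n k)) λ π → size π ≤ eval p ∥ Schrijver n k ∥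
corollary1 k 1≤k = monomial (suc (width k) ^ degree k) (degree k) , λ n 2k≤n → bounded n 2k≤n
  where
  bounded : ∀ n → 2 * k ≤ n → Σ (Refutation (Schrijver n k)) λ π →
            size π ≤ eval (monomial (suc (width k) ^ degree k) (degree k)) ∥ Schrijver n k ∥
  bounded n 2k≤n = proj₁ result , (begin
    size (proj₁ result)                   ≤⟨ proj₂ result ⟩
    3 + (B ^ 15 + (n * B ^ 106 + B ^ M))  ≤⟨ lines≤ ⟩
    B ^ (3 + (106 + M))
      ≡⟨ cong (_^ (3 + (106 + M))) (cong (W *_) (sym (*-identityʳ W))) ⟩
    (W ^ 2) ^ (3 + (106 + M))             ≡⟨ ^-*-assoc W 2 (3 + (106 + M)) ⟩
    W ^ degree k                          ≤⟨ ^-monoˡ-≤ (degree k) W≤ ⟩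
    (s * suc (width k)) ^ degree k        ≡⟨ ^-distribʳ-* (degree k) s (suc (width k)) ⟩
    s ^ degree k * suc (width k) ^ degree k ≡⟨ eval-monomial (suc (width k) ^ degree k) (degree k) s ⟨
    eval (monomial (suc (width k) ^ degree k) (degree k)) s ∎)
    where
    open ≤-Reasoning
    s = ∥ Schrijver n k ∥
    W = s + width k
    -- A square, so as to bound also the lists of pairs: centres and pigeons by n², positions in two
    -- sets by k².
    B = W * W
    c = n ∸ 2 * k + 1
    L = stableSubsets n k
    5≤W : 5 ≤ W
    5≤W = ≤-trans (m≤n+m 5 (2 * k)) (m≤n+m (width k) s)
    W≤B : W ≤ B
    W≤B = ≤-trans (≤-reflexive (sym (*-identityʳ W))) (*-monoʳ-≤ W (≤-trans (s≤s z≤n) 5≤W))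
    5≤B = ≤-trans 5≤W W≤B
    k≤W : k ≤ W
    k≤W = ≤-trans (m≤m+n k (k + 0)) (≤-trans (m≤m+n (2 * k) 5) (m≤n+m (width k) s))
    n≤W : n ≤ W
    n≤W = ≤-trans (n≤1+n n) (≤-trans (≤-reflexive (sym (colours+2k n k 1≤k 2k≤n)))
            (+-mono-≤ (colours≤size n k 1≤k 2k≤n) (m≤m+n (2 * k) 5)))
    N≤B : length L ≤ B
    N≤B = ≤-trans (vertices≤size n k 1≤k 2k≤n) (≤-trans (m≤m+n s _) W≤B)
    c≤B : c ≤ B
    c≤B = ≤-trans (colours≤size n k 1≤k 2k≤n) (≤-trans (m≤m+n s _) W≤B)
    open Calculus B 5≤B
    open Pigeonhole B 5≤B
    open Refuting B 5≤B k 1≤k (*-mono-≤ k≤W k≤W)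
    open Translation n k 1≤k 2k≤n B 5≤B c≤B
    M = 2 ^ threshold k * threshold k * 6 + 7
    F = hasColour n k 1≤k 2k≤n
    result : Σ (Refutation (Schrijver n k)) λ π → size π ≤ 3 + (B ^ 15 + (n * B ^ 106 + B ^ M))
    result = toRefutation (cutColouring {e = 11} L (disjointPairs n k) (allFin c) F
      N≤B (length-disjointPairs n k N≤B) (subst (_≤ B) (sym (length-allFin c)) c≤B)
      hasColour-some
      (λ AC∈ _ → let A∈ , C∈ , empty = ∈-disjointPairs⁻ n k AC∈ in hasColour-proper A∈ C∈ empty)
      (refute n c F (1≤colours n k 1≤k 2k≤n) (colours+2k n k 1≤k 2k≤n) N≤B (*-mono-≤ n≤W n≤W)))
    lines≤ : 3 + (B ^ 15 + (n * B ^ 106 + B ^ M)) ≤ B ^ (3 + (106 + M))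
    lines≤ = begin
      3 + (B ^ 15 + (n * B ^ 106 + B ^ M))
        ≤⟨ +-mono-≤ 3≤P (+-mono-≤ (power {15} (m≤m+n 15 (92 + M)))
        (+-mono-≤ nB≤P (power {M} (m≤n+m M 107)))) ⟩
      P + (P + (P + P))                     ≤⟨ +-monoʳ-≤ P (+-monoʳ-≤ P (+-monoʳ-≤ P (m≤m+n P _))) ⟩
      5 * P                                 ≤⟨ 5*≤ {V = V} (107 + M) ⟩
      B ^ (2 + (106 + M))                   ≤⟨ B^≤ {V = V} (2 + (106 + M)) ⟩
      B ^ (3 + (106 + M))                   ∎
      where
      V = SchrijverVar n k
      P = B ^ (107 + M)
      power : ∀ {i} → i ≤ 107 + M → B ^ i ≤ P
      power = ^-monoʳ-≤ B
        where instance _ = >-nonZero (≤-trans (s≤s z≤n) 5≤B)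
      3≤P : 3 ≤ P
      3≤P = ≤-trans (≤-trans (m≤m+n 3 2) 5≤B)
        (≤-trans (≤-reflexive (sym (*-identityʳ B))) (power {1} (s≤s z≤n)))
      nB≤P : n * B ^ 106 ≤ P
      nB≤P = ≤-trans (*-monoˡ-≤ (B ^ 106) (≤-trans n≤W W≤B)) (power {107} (m≤m+n 107 M))
    W≤ : W ≤ s * suc (width k)
    W≤ = ≤-trans (+-monoʳ-≤ s
      (≤-trans (≤-reflexive (sym (*-identityˡ (width k)))) (*-monoˡ-≤ (width k) 1≤s)))
                 (≤-reflexive (sym (*-suc s (width k))))
      where
      1≤s : 1 ≤ s
      1≤s = ≤-trans (1≤colours n k 1≤k 2k≤n) (colours≤size n k 1≤k 2k≤n)
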